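{- Let $w\in\widetilde{S_n}$ and let $(P,Q,\rho)$ be its image under AMBC, with $P,Q$ of shape $\lambda$. Then \[\operatorname{sgn}(w)\cdot(-1)^{\sum_{i=1}^n (w(i)-i)}=(-1)^{\operatorname{inv}(P)+\operatorname{inv}(Q)+\operatorname{inv}(\lambda)+\operatorname{inv}_\lambda(\rho)}.\]
   Context: Fix $n\ge1$. For $i\in\mathbb Z$ write $\overline{i}=i+n\mathbb Z$, $[\overline n]=\{\overline 1,\dots,\overline n\}$. $\widetilde{S_n}$ is the set of bijections $w:\mathbb Z\to\mathbb Z$ with $w(i+n)=w(i)+n$; more generally a partial permutation is an injection $w:U\to\mathbb Z$ with $U\subseteq\mathbb Z$ stable under $x\mapsto x\pm n$ and $w(i+n)=w(i)+n$. The balls of $w$ are the points $(i,w(i))$ (first coordinate = row, increasing southward; second = column, increasing eastward). A cell $(i,j)$ is northwest of $(i',j')$ if $i\le i'$, $j\le j'$ (strictly if both strict), northeast if $i\le i'$, $j\ge j'$, southwest if $i\ge i'$, $j\le j'$. Translates: images under $(i,j)\mapsto(i+kn,j+kn)$. AMBC. For a nonempty partial permutation $w$: a channel is a set of balls, invariant under translation by $(n,n)$, totally ordered by the northwest order, with maximal number of translation classes among such sets. There is a unique southwest-most channel $C$ (for every channel $C'$, each ball of $C$ is weakly southwest of some ball of $C'$). Number $C$ by consecutive integers $\tilde d$ increasing from northwest to southeast; for each ball $b$ set $d(b)=\max(\tilde d(b_k)+k)$ over sequences of balls $b=b_0,\dots,b_k$ with $b_{t+1}$ strictly northwest of $b_t$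 and $b_k\in C$ (finite). For each $t$, write the balls with $d=t$ as $(i_1,j_1),\dots,(i_s,j_s)$, $i_1<\dots<i_s$ (so $j_1>\dots>j_s$); outer corners are $(i_{r+1},j_r)$, $1\le r<s$; back corner is $(i_1,j_s)$. $\mathrm{fw}(w)$ is the partial permutation whose balls are all outer corners; $S$ is the set of back corners. Record the residues mod $n$ of the column indices of $S$ as the next row of $P$, of the row indices as the next row of $Q$, and $\sum_c(\lceil c_2/n\rceil-\lceil c_1/n\rceil)$ (one representative $c=(c_1,c_2)$ per translation class of $S$) as the next entry of $\rho$; then replace $w$ by $\mathrm{fw}(w)$ and repeat until empty. For $w\in\widetilde{S_n}$, $P,Q$ are tabloids of a common shape $\lambda$, a partition of $n$ ($\lambda_r$ = number of translation classes of back corners at step $r$), each containing every element of $[\overline n]$ once; a tabloid is a sequence of disjoint subsets (rows) of $[\overline n]$, row 1 highest. $\rho\in\mathbb Z^{\ell(\lambda)}$. Sign: the length $\ell(w)$ is the number of translation classes (under simultaneous translation by $(n,n)$) of pairs $(a,b)$ of balls of $w$ with $a$ strictly northeast of $b$; $\operatorname{sgn}(w)=(-1)^{\ell(w)}$. Broken order: the linear order $\overline1<\overline2<\dots<\overline n$ on $[\overline n]$. For a tabloid $T$, $\operatorname{inv}(T)$ is the number of pairs $\overline i<\overline j$ (broken order) such that $\overline i$ is in a strictly lower row of $T$ than $\overline j$. For a partition $\lambda$, $\operatorname{inv}(\lambda)=\lambda_2+\lambda_4+\lambda_6+\cdots$. For $\rho\in\mathbb Z^{\ell(\lambda)}$,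 $\operatorname{inv}_\lambda(\rho)=\sum_{i:\ \lambda_i \text{ odd}}\rho_i$. -}

module Defs where

open import Algebra.Properties.CommutativeMonoid.Sum as Sum using ()
open import Data.Bool.Base using (if_then_else_)
open import Data.Fin.Base as Fin using (Fin; toℕ)
open import Data.Fin.Properties as Fin using (any?)
open import Data.Fin.Subset using (Subset; _∩_; Empty) renaming (_∈_ to _∈ₛ_)
open import Data.Fin.Subset.Properties using (_∈?_)
open import Data.Integer.Base using (ℤ; +_; 0ℤ; -1ℤ; _+_; _-_; _*_; -_; _^_; _≤_; _<_; _/ℕ_; ∣_∣)
open import Data.Integer.Divisibility using (_∣_)
import Data.Integer.Properties as ℤ
open import Data.List.Base using (List; []; _∷_)
open import Data.List.Membership.Propositional using (_∈_)
open import Data.List.NonEmpty as List⁺ using (List⁺)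
open import Data.List.Relation.Unary.Linked using (Linked)
open import Data.Maybe.Base as Maybe using (Maybe; just)
open import Data.Maybe.Properties using (just-injective)
open import Data.Nat.Base as ℕ using (ℕ; suc; NonZero)
import Data.Nat.Properties as ℕ
open import Data.Product.Base using (Σ; ∃; ∃₂; _×_; _,_; proj₁; proj₂)
open import Data.Sum.Base using (_⊎_)
open import Data.Vec.Base using (Vec; []; _∷_; lookup)
open import Function.Bundles using (_⇔_)
open import Function.Definitions using (Bijective)
open import Level using (0ℓ)
open import Relation.Binary.Core using (Rel)
open import Relation.Binary.PropositionalEquality using (_≡_; _≢_; sym; trans; cong)
open import Relation.Nullary.Decidable using (Dec; ⌊_⌋; _×-dec_)
open import Relation.Nullary.Negation using (¬_)
open import Relation.Unary using (Pred)

open Sum ℤ.+-0-commutativeMonoid using () renaming (sum to ∑ℤ) public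
open Sum ℕ.+-0-commutativeMonoid using () renaming (sum to ∑ℕ) public

-- Also correct for negative z, because -1 is its own inverse.
-1^_ : ℤ → ℤ
-1^ z = -1ℤ ^ ∣ z ∣

-- k : Fin n stands for the residue class of toℕ k + 1, so that the order of
-- Fin n is the broken order 1̄ < 2̄ < … < n̄.
rep : ∀ {n} → Fin n → ℤ
rep k = + suc (toℕ k)

_∈̄_ : ∀ {n} → ℤ → Fin n → Set
_∈̄_ {n} x k = + n ∣ (x - rep k)

-- _/ℕ_ rounds towards -∞.
⌈_/_⌉ : ℤ → (n : ℕ) .{{_ : NonZero n}} → ℤ
⌈ x / n ⌉ = - ((- x) /ℕ n)

------------------------------------------------------------------------
-- Cells

Cell : Set
Cell = ℤ × ℤ

row col : Cell → ℤ
row = proj₁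
col = proj₂

_NorthWestOf_ _StrictlyNorthWestOf_ _SouthWestOf_ _StrictlyNorthEastOf_ : Rel Cell 0ℓ
a NorthWestOf b         = row a ≤ row b × col a ≤ col b
a StrictlyNorthWestOf b = row a < row b × col a < col b
a SouthWestOf b         = row b ≤ row a × col a ≤ col b
a StrictlyNorthEastOf b = row a < row b × col b < col a

translate : ℕ → ℤ → Cell → Cell
translate n k (i , j) = i + k * + n , j + k * + n

Translates : ℕ → Rel Cell 0ℓ
Translates n a b = ∃ λ k → b ≡ translate n k a

PairTranslates : ℕ → Rel (Cell × Cell) 0ℓ
PairTranslates n (a , a′) (b , b′) = ∃ λ k → b ≡ translate n k a × b′ ≡ translate n k a′

-- One representative from each ~-class of S; "S has k classes" means that a
-- system of k representatives exists.
record IsTransversal {A : Set} (_~_ : Rel A 0ℓ) (S : Pred A 0ℓ) {k : ℕ} (reps : Fin k → A) : Set where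
  field
    member   : ∀ x → S (reps x)
    distinct : ∀ x y → reps x ~ reps y → x ≡ y
    complete : ∀ {a} → S a → ∃ λ x → reps x ~ a

HasClasses : {A : Set} → Rel A 0ℓ → Pred A 0ℓ → ℕ → Set
HasClasses {A} _~_ S k = Σ (Fin k → A) (IsTransversal _~_ S)

------------------------------------------------------------------------
-- Permutations

record AffinePerm (n : ℕ) : Set where
  field
    to        : ℤ → ℤ
    bijective : Bijective _≡_ _≡_ to
    periodic  : ∀ i → to (i + + n) ≡ to i + + n

-- The domain U is the set of i with fun i ≢ nothing; periodicity includes its
-- stability under translation by n in both directions.
record PartialPerm (n : ℕ) : Set where
  field
    fun       : ℤ → Maybe ℤ
    injective : ∀ {i i′ j} → fun i ≡ just j → fun i′ ≡ just j → i ≡ i′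
    periodic  : ∀ i → fun (i + + n) ≡ Maybe.map (_+ + n) (fun i)

toPartial : ∀ {n} → AffinePerm n → PartialPerm n
toPartial w = record
  { fun       = λ i → just (to i)
  ; injective = λ p q → proj₁ bijective (trans (just-injective p) (sym (just-injective q)))
  ; periodic  = λ i → cong just (periodic i)
  }
  where open AffinePerm w

module _ {n : ℕ} (w : PartialPerm n) where
  open PartialPerm w

  Ball : Pred Cell 0ℓ
  Ball (i , j) = fun i ≡ just j

  Inversion : Pred (Cell × Cell) 0ℓ
  Inversion (a , b) = Ball a × Ball b × a StrictlyNorthEastOf b

IsLength : ∀ {n} → AffinePerm n → ℕ → Set
IsLength {n} w ℓ = HasClasses (PairTranslates n) (Inversion (toPartial w)) ℓ

------------------------------------------------------------------------
-- Channels and numberings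

module _ {n : ℕ} (w : PartialPerm n) where

  record IsStream (C : Pred Cell 0ℓ) : Set where
    field
      balls     : ∀ {c} → C c → Ball w c
      invariant : ∀ {c} k → C c → C (translate n k c)
      total     : ∀ {c c′} → C c → C c′ → c NorthWestOf c′ ⊎ c′ NorthWestOf c

  record IsChannel (C : Pred Cell 0ℓ) : Set₁ where
    field
      isStream : IsStream C
      size     : ℕ
      classes  : HasClasses (Translates n) C size
      maximal  : ∀ (D : Pred Cell 0ℓ) k → IsStream D → HasClasses (Translates n) D k → k ℕ.≤ size

  record IsSouthWestChannel (C : Pred Cell 0ℓ) : Set₁ where
    field
      isChannel : IsChannel C
      southWest : ∀ (D : Pred Cell 0ℓ) → IsChannel D → ∀ {b} → C b → ∃ λ b′ → D b′ × b SouthWestOf b′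

  -- Path b k c: a sequence b = b₀ , … , bₖ = c of balls, each bₜ₊₁ strictly
  -- northwest of bₜ.
  data Path : Cell → ℕ → Cell → Set where
    stop : ∀ {b} → Ball w b → Path b 0 b
    step : ∀ {b b′ k c} → Ball w b → b′ StrictlyNorthWestOf b → Path b′ k c → Path b (suc k) c

  record IsMaxPathValue (C : Pred Cell 0ℓ) (d̃ : Cell → ℤ) (b : Cell) (m : ℤ) : Set where
    field
      attained : ∃₂ λ k c → Path b k c × C c × m ≡ d̃ c + + k
      bound    : ∀ {k c} → Path b k c → C c → d̃ c + + k ≤ m

-- Strictly increasing and onto ℤ; values of d̃ outside C are irrelevant.
record IsNumbering (C : Pred Cell 0ℓ) (d̃ : Cell → ℤ) : Set where
  field
    increasing  : ∀ {c c′} → C c → C c′ → c StrictlyNorthWestOf c′ → d̃ c < d̃ c′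
    consecutive : ∀ t → ∃ λ c → C c × d̃ c ≡ t

------------------------------------------------------------------------
-- Affine matrix-ball construction

-- The argument lists the balls of one level in order of increasing row.
outerCorners : List Cell → List Cell
outerCorners (a ∷ b ∷ cs) = (row b , col a) ∷ outerCorners (b ∷ cs)
outerCorners _            = []

backCorner : List⁺ Cell → Cell
backCorner cs = row (List⁺.head cs) , col (List⁺.last cs)

-- One step: p, q, l and r are the row of P, the row of Q, the part of λ and
-- the entry of ρ that it contributes, and w′ = fw(w).
record Step {n : ℕ} .{{_ : NonZero n}} (w : PartialPerm n) (p q : Subset n) (l : ℕ) (r : ℤ)
            (w′ : PartialPerm n) : Set₁ where
  field
    C           : Pred Cell 0ℓ
    C-southWest : IsSouthWestChannel w C
    d̃           : Cell → ℤ
    d̃-numbering : IsNumbering C d̃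
    d           : Cell → ℤ
    d-max       : ∀ {b} → Ball w b → IsMaxPathValue w C d̃ b (d b)

    level        : ℤ → List⁺ Cell
    level-balls  : ∀ t c → c ∈ List⁺.toList (level t) ⇔ (Ball w c × d c ≡ t)
    level-sorted : ∀ t → Linked (λ a b → row a < row b) (List⁺.toList (level t))

    forward : ∀ c → Ball w′ c ⇔ ∃ λ t → c ∈ outerCorners (List⁺.toList (level t))

  S : Pred Cell 0ℓ
  S c = ∃ λ t → c ≡ backCorner (level t)

  field
    reps        : Fin l → Cell
    transversal : IsTransversal (Translates n) S reps
    p-columns   : ∀ k → k ∈ₛ p ⇔ ∃ λ c → S c × col c ∈̄ k
    q-rows      : ∀ k → k ∈ₛ q ⇔ ∃ λ c → S c × row c ∈̄ k
    r-sum       : r ≡ ∑ℤ (λ x → ⌈ col (reps x) / n ⌉ - ⌈ row (reps x) / n ⌉)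

-- The arguments are, in order, w, the rows of P, the rows of Q, λ and ρ.
data AMBC {n : ℕ} .{{_ : NonZero n}} :
       PartialPerm n → ∀ {m} → Vec (Subset n) m → Vec (Subset n) m → Vec ℕ m → Vec ℤ m → Set₁ where
  done : ∀ {w} → (∀ c → ¬ Ball w c) → AMBC w [] [] [] []
  next : ∀ {w w′ m p q l r} {P Q : Vec (Subset n) m} {L R} →
         ∃ (Ball w) → Step w p q l r w′ → AMBC w′ P Q L R →
         AMBC w (p ∷ P) (q ∷ Q) (l ∷ L) (r ∷ R)

------------------------------------------------------------------------
-- Inversion statistics

record Tabloid (n m : ℕ) : Set where
  field
    rows     : Vec (Subset n) m
    disjoint : ∀ s t → s ≢ t → Empty (lookup rows s ∩ lookup rows t)

open Tabloid public using (rows)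

module _ {n m : ℕ} (T : Tabloid n m) where

  InLowerRow : Rel (Fin n) 0ℓ
  InLowerRow i j = ∃₂ λ s t → t Fin.< s × i ∈ₛ lookup (rows T) s × j ∈ₛ lookup (rows T) t

  inLowerRow? : ∀ i j → Dec (InLowerRow i j)
  inLowerRow? i j = any? λ s → any? λ t →
    t Fin.<? s ×-dec i ∈? lookup (rows T) s ×-dec j ∈? lookup (rows T) t

  inv : ℕ
  inv = ∑ℕ λ i → ∑ℕ λ j → if ⌊ i Fin.<? j ×-dec inLowerRow? i j ⌋ then 1 else 0

invShape : ∀ {m} → Vec ℕ m → ℕ
invShape (_ ∷ l ∷ L) = l ℕ.+ invShape L
invShape _           = 0

invWeight : ∀ {m} → Vec ℕ m → Vec ℤ m → ℤ
invWeight L ρ = ∑ℤ λ i → if ⌊ lookup L i ℕ.% 2 ℕ.≟ 1 ⌋ then lookup ρ i else 0ℤ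

-- ∑_{i=1}^n (w(i) - i)
displacement : ∀ {n} → AffinePerm n → ℤ
displacement {n} w = ∑ℤ λ (k : Fin n) → AffinePerm.to w (rep k) - rep k

{-# OPTIONS --safe #-}
module Submission where

-- Everything is computed modulo 2.  Listing one ball from each translation
-- class, let the crossings be the number of inversions of the list of row
-- residues plus that of the column residues (in the broken order); a
-- permutation of the list changes both summands by its sign, and a translation
-- changes neither.  Let the winding be the sum of ⌈col/n⌉ - ⌈row/n⌉.  Counting
-- inversions by residues gives ℓ(w) = crossings + (n - 1) winding, and the
-- displacement is n · winding, so the left-hand side is the parity of
-- crossings + winding.
--
-- In one step, replacing the balls of each level by its back corner and outer
-- corners keeps the rows and rotates the columns cyclically, which costs one
-- sign for every outer corner and preserves the winding.  The l back corners
-- form a periodic increasing sequence, so their crossings are (l - 1) r, where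
-- r is their winding.  Listing the back corners before the outer corners, the
-- mixed inversions are those counted by inv(P) and inv(Q) between the first
-- row and the rows below it.

open import Algebra.Solver.Ring.AlmostCommutativeRing using (fromCommutativeRing)
import Algebra.Solver.Ring.Simple as RingSolver
open import Data.Bool.Base using (if_then_else_)
open import Data.Empty using (⊥)
open import Data.Fin.Base as Fin using (Fin; toℕ; fromℕ<; opposite)
import Data.Fin.Properties as Fin
open import Data.Fin.Subset using (Subset; _∩_; Empty) renaming (_∈_ to _∈ₛ_)
open import Data.Fin.Subset.Properties using (_∈?_; x∈p∩q⁺)
open import Data.Integer.Base as ℤ using (ℤ; +_; -[1+_]; ∣_∣; -1ℤ; 0ℤ; 1ℤ; _+_; _-_; _*_; -_; _≤_; _<_)
open import Data.Integer.DivMod using (n%ℕd<d; a≡a%ℕn+[a/ℕn]*n)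
open import Data.Integer.Divisibility.Signed using (divides; ∣ᵤ⇒∣; ∣⇒∣ᵤ)
import Data.Integer.Properties as ℤ
open import Data.Integer.Tactic.RingSolver using (solve-∀)
open import Data.List.Base using (List; []; _∷_; _++_; map; concatMap; filter; length; tabulate; allFin; upTo; _∷ʳ_)
open import Data.List.Membership.Propositional using (_∈_; find; lose)
open import Data.List.Membership.Propositional.Properties using (∈-allFin; ∈-concatMap⁺; ∈-concatMap⁻; ∈-filter⁺; ∈-filter⁻; ∈-map⁺; ∈-map⁻; ∈-tabulate⁺; ∈-tabulate⁻; ∈-upTo⁺; ∈-upTo⁻; ∈-++⁺ˡ; ∈-++⁺ʳ; ∈-++⁻)
open import Data.List.Membership.Propositional.Properties.WithK using (unique∧set⇒bag)
open import Data.List.NonEmpty as List⁺ using (List⁺; toList; _∷_)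
import Data.List.Properties as List
open import Data.List.Relation.Binary.BagAndSetEquality using (∼bag⇒↭)
open import Data.List.Relation.Binary.Disjoint.Propositional using (Disjoint)
open import Data.List.Relation.Binary.Permutation.Propositional as ↭ using (_↭_; prep; swap; ↭-sym; ↭-trans)
import Data.List.Relation.Binary.Permutation.Propositional.Properties as ↭
import Data.List.Relation.Binary.Permutation.Setoid.Properties as ↭ₛ
open import Data.List.Relation.Unary.All as All using ([]; _∷_)
import Data.List.Relation.Unary.All.Properties as All
open import Data.List.Relation.Unary.AllPairs as AllPairs using (AllPairs; []; _∷_)
import Data.List.Relation.Unary.AllPairs.Properties as AllPairs
open import Data.List.Relation.Unary.Any using (here; there)
open import Data.List.Relation.Unary.Linked.Properties using (Linked⇒AllPairs)
open import Data.List.Relation.Unary.Unique.Propositional using (Unique)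
import Data.List.Relation.Unary.Unique.Propositional.Properties as Unique
open import Data.Maybe.Base using (just; nothing)
open import Data.Maybe.Properties using (just-injective)
open import Data.Nat.Base as ℕ using (ℕ; zero; suc; NonZero; parity)
import Data.Nat.Properties as ℕ
open import Data.Parity.Base using (Parity; 0ℙ; 1ℙ) renaming (_+_ to infixl 6 _⊕_; _*_ to infixl 7 _⊗_)
import Data.Parity.Properties as ℙ
open import Data.Product.Base using (Σ; ∃; _×_; _,_; proj₁; proj₂)
open import Data.Sum.Base using (_⊎_; inj₁; inj₂)
open import Data.Vec.Base as Vec using (Vec; []; _∷_; lookup)
open import Function.Base using (_∘_; _$_; id)
open import Function.Bundles using (Equivalence; _⇔_; mk⇔)
open import Level using (0ℓ)
open import Relation.Binary.Core using (Rel)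
open import Relation.Binary.Definitions using (Asymmetric; tri<; tri≈; tri>)
open import Relation.Binary.PropositionalEquality
open import Relation.Nullary.Decidable using (Dec; yes; no; ⌊_⌋; _×-dec_)
open import Relation.Nullary.Negation using (contradiction)
open import Relation.Unary using (Pred; Decidable)

open import Defs

open ≡-Reasoning

-- The inversion parity of the row residues alone depends on the order in which the classes are
-- listed. Adding that of the column residues removes this dependence, and residues do not see the
-- choice of representatives; for this the residues in each list must be distinct. Two lists of
-- cells are compared through `key`, which keeps of a cell exactly its translation class.
--
-- To work with finitely many levels, the numbering must be periodic. Translation by (n,n) acts on
-- the numbers of the channel as an increasing bijection of ℤ, hence adds a constant m > 0, and the
-- levels 1, ..., m form one period.
--
-- The two terms that depend on the shape arise as follows. The outer corners of step s number
-- λ_(s+1) + λ_(s+2) + ...; over all steps the part λ_s is counted s - 1 times, which modulo 2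
-- leaves λ_2 + λ_4 + .... The back corners of a step with part l and entry r contribute (l - 1) r
-- through their crossings and r through their winding, together l r, so that only odd parts keep
-- their entry of ρ.

private variable
  A A′ : Set
  m n : ℕ

module ℙ-Solver = RingSolver (fromCommutativeRing ℙ.+-*-commutativeRing) ℙ._≟_
open ℙ-Solver using (solve; con; _:=_; _:+_; _:*_)

-- Parity of integers

par : ℤ → Parity
par z = parity ∣ z ∣

parity-suc : ∀ k → parity (suc k) ≡ 1ℙ ⊕ parity k
parity-suc = ℙ.+-homo-+ 1

par-⊖ : ∀ k l → par (k ℤ.⊖ l) ≡ parity k ⊕ parity l
par-⊖ k zero = sym (ℙ.+-identityʳ (parity k))
par-⊖ zero (suc l) = refl
par-⊖ (suc k) (suc l) = begin
  par (suc k ℤ.⊖ suc l)              ≡⟨ cong par (ℤ.[1+m]⊖[1+n]≡m⊖n k l) ⟩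
  par (k ℤ.⊖ l)                      ≡⟨ par-⊖ k l ⟩
  parity k ⊕ parity l                ≡⟨ solve 2 (λ a b → a :+ b := (con 1ℙ :+ a) :+ (con 1ℙ :+ b)) refl (parity k) (parity l) ⟩
  (1ℙ ⊕ parity k) ⊕ (1ℙ ⊕ parity l)  ≡⟨ cong₂ _⊕_ (parity-suc k) (parity-suc l) ⟨
  parity (suc k) ⊕ parity (suc l)    ∎

par-+ : ∀ a b → par (a ℤ.+ b) ≡ par a ⊕ par b
par-+ (+ k)    (+ l)    = ℙ.+-homo-+ k l
par-+ (+ k)    -[1+ l ] = par-⊖ k (suc l)
par-+ -[1+ k ] (+ l)    = trans (par-⊖ l (suc k)) (ℙ.+-comm (parity l) (parity (suc k)))
par-+ -[1+ k ] -[1+ l ] = begin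
  parity (k ℕ.+ l)                   ≡⟨ ℙ.+-homo-+ k l ⟩
  parity k ⊕ parity l                ≡⟨ solve 2 (λ a b → a :+ b := (con 1ℙ :+ a) :+ (con 1ℙ :+ b)) refl (parity k) (parity l) ⟩
  (1ℙ ⊕ parity k) ⊕ (1ℙ ⊕ parity l)  ≡⟨ cong₂ _⊕_ (parity-suc k) (parity-suc l) ⟨
  parity (suc k) ⊕ parity (suc l)    ∎

par-neg : ∀ a → par (ℤ.- a) ≡ par a
par-neg a = cong parity (ℤ.∣-i∣≡∣i∣ a)

par-minus : ∀ a b → par (a ℤ.- b) ≡ par a ⊕ par b
par-minus a b = trans (par-+ a (ℤ.- b)) (cong (par a ⊕_) (par-neg b))

par-* : ∀ a b → par (a ℤ.* b) ≡ par a ⊗ par b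
par-* a b = trans (cong parity (ℤ.∣i*j∣≡∣i∣*∣j∣ a b)) (ℙ.*-homo-* ∣ a ∣ ∣ b ∣)

signOf : Parity → ℤ
signOf 0ℙ = 1ℤ
signOf 1ℙ = -1ℤ

signOf-⊕ : ∀ p q → signOf (p ⊕ q) ≡ signOf p ℤ.* signOf q
signOf-⊕ 0ℙ q  = sym (ℤ.*-identityˡ (signOf q))
signOf-⊕ 1ℙ 0ℙ = refl
signOf-⊕ 1ℙ 1ℙ = refl

-1^-signOf : ∀ z → -1^ z ≡ signOf (par z)
-1^-signOf z = go ∣ z ∣
  where
  go : ∀ k → -1ℤ ℤ.^ k ≡ signOf (parity k)
  go zero    = refl
  go (suc k) = begin
    -1ℤ ℤ.* -1ℤ ℤ.^ k            ≡⟨ cong (-1ℤ ℤ.*_) (go k) ⟩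
    -1ℤ ℤ.* signOf (parity k)    ≡⟨ signOf-⊕ 1ℙ (parity k) ⟨
    signOf (1ℙ ⊕ parity k)       ≡⟨ cong signOf (parity-suc k) ⟨
    signOf (parity (suc k))      ∎

-- Sums over lists

sumOf : (A → Parity) → List A → Parity
sumOf f []       = 0ℙ
sumOf f (x ∷ xs) = f x ⊕ sumOf f xs

sumOf-++ : ∀ (f : A → Parity) xs ys → sumOf f (xs ++ ys) ≡ sumOf f xs ⊕ sumOf f ys
sumOf-++ f []       ys = refl
sumOf-++ f (x ∷ xs) ys = trans (cong (f x ⊕_) (sumOf-++ f xs ys)) (sym (ℙ.+-assoc (f x) _ _))

sumOf-map : ∀ (f : A′ → Parity) (g : A → A′) xs → sumOf f (map g xs) ≡ sumOf (f ∘ g) xs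
sumOf-map f g []       = refl
sumOf-map f g (x ∷ xs) = cong (f (g x) ⊕_) (sumOf-map f g xs)

sumOf-cong-∈ : ∀ {f g : A → Parity} xs → (∀ {x} → x ∈ xs → f x ≡ g x) → sumOf f xs ≡ sumOf g xs
sumOf-cong-∈ []       eq = refl
sumOf-cong-∈ (x ∷ xs) eq = cong₂ _⊕_ (eq (here refl)) (sumOf-cong-∈ xs (eq ∘ there))

sumOf-cong : ∀ {f g : A → Parity} xs → (∀ x → f x ≡ g x) → sumOf f xs ≡ sumOf g xs
sumOf-cong xs eq = sumOf-cong-∈ xs (λ {x} _ → eq x)

sumOf-⊕ : ∀ (f g : A → Parity) xs → sumOf (λ x → f x ⊕ g x) xs ≡ sumOf f xs ⊕ sumOf g xs
sumOf-⊕ f g []       = refl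
sumOf-⊕ f g (x ∷ xs) = begin
  (f x ⊕ g x) ⊕ sumOf (λ y → f y ⊕ g y) xs   ≡⟨ cong ((f x ⊕ g x) ⊕_) (sumOf-⊕ f g xs) ⟩
  (f x ⊕ g x) ⊕ (sumOf f xs ⊕ sumOf g xs)    ≡⟨ solve 4 (λ a b c d → (a :+ b) :+ (c :+ d) := (a :+ c) :+ (b :+ d)) refl (f x) (g x) _ _ ⟩
  (f x ⊕ sumOf f xs) ⊕ (g x ⊕ sumOf g xs)    ∎

sumOf-⊗ : ∀ p (f : A → Parity) xs → sumOf (λ x → p ⊗ f x) xs ≡ p ⊗ sumOf f xs
sumOf-⊗ p f []       = sym (ℙ.*-zeroʳ p)
sumOf-⊗ p f (x ∷ xs) = trans (cong (p ⊗ f x ⊕_) (sumOf-⊗ p f xs)) (sym (ℙ.*-distribˡ-+ p (f x) _))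

sumOf-0 : ∀ (xs : List A) → sumOf (λ _ → 0ℙ) xs ≡ 0ℙ
sumOf-0 []       = refl
sumOf-0 (x ∷ xs) = sumOf-0 xs

sumOf-const : ∀ p (xs : List A) → sumOf (λ _ → p) xs ≡ parity (length xs) ⊗ p
sumOf-const p []       = refl
sumOf-const p (x ∷ xs) = begin
  p ⊕ sumOf (λ _ → p) xs              ≡⟨ cong (p ⊕_) (sumOf-const p xs) ⟩
  p ⊕ parity (length xs) ⊗ p          ≡⟨ solve 2 (λ p l → p :+ l :* p := (con 1ℙ :+ l) :* p) refl p (parity (length xs)) ⟩
  (1ℙ ⊕ parity (length xs)) ⊗ p       ≡⟨ cong (_⊗ p) (parity-suc (length xs)) ⟨
  parity (suc (length xs)) ⊗ p        ∎

sumOf-↭ : ∀ (f : A → Parity) {xs ys} → xs ↭ ys → sumOf f xs ≡ sumOf f ys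
sumOf-↭ f ↭.refl         = refl
sumOf-↭ f (prep x p)     = cong (f x ⊕_) (sumOf-↭ f p)
sumOf-↭ f (swap {xs} {ys} x y p) = begin
  f x ⊕ (f y ⊕ sumOf f xs)   ≡⟨ cong (λ s → f x ⊕ (f y ⊕ s)) (sumOf-↭ f p) ⟩
  f x ⊕ (f y ⊕ sumOf f ys)   ≡⟨ solve 3 (λ a b c → a :+ (b :+ c) := b :+ (a :+ c)) refl (f x) (f y) _ ⟩
  f y ⊕ (f x ⊕ sumOf f ys)   ∎
sumOf-↭ f (↭.trans p q)  = trans (sumOf-↭ f p) (sumOf-↭ f q)

sumOf-swap : ∀ (h : A → A′ → Parity) xs ys →
             sumOf (λ x → sumOf (h x) ys) xs ≡ sumOf (λ y → sumOf (λ x → h x y) xs) ys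
sumOf-swap h []       ys = sym (sumOf-0 ys)
sumOf-swap h (x ∷ xs) ys = begin
  sumOf (h x) ys ⊕ sumOf (λ x → sumOf (h x) ys) xs             ≡⟨ cong (sumOf (h x) ys ⊕_) (sumOf-swap h xs ys) ⟩
  sumOf (h x) ys ⊕ sumOf (λ y → sumOf (λ x → h x y) xs) ys     ≡⟨ sumOf-⊕ (h x) _ ys ⟨
  sumOf (λ y → h x y ⊕ sumOf (λ x → h x y) xs) ys              ∎

-- Connects the sums over `Fin n` of the statement with sums over lists. The map `h` is free, so
-- that the list may hold keys of representatives as well as indices.
par-∑ℤ : ∀ (g : A → Parity) (h : Fin n → A) (f : Fin n → ℤ) → (∀ i → g (h i) ≡ par (f i)) →
         sumOf g (tabulate h) ≡ par (∑ℤ f)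
par-∑ℤ {n = zero}  g h f eq = refl
par-∑ℤ {n = suc n} g h f eq =
  trans (cong₂ _⊕_ (eq Fin.zero) (par-∑ℤ g (h ∘ Fin.suc) (f ∘ Fin.suc) (eq ∘ Fin.suc)))
        (sym (par-+ (f Fin.zero) (∑ℤ (f ∘ Fin.suc))))

parity-∑ℕ : ∀ (g : A → Parity) (h : Fin n → A) (f : Fin n → ℕ) → (∀ i → g (h i) ≡ parity (f i)) →
            sumOf g (tabulate h) ≡ parity (∑ℕ f)
parity-∑ℕ {n = zero}  g h f eq = refl
parity-∑ℕ {n = suc n} g h f eq =
  trans (cong₂ _⊕_ (eq Fin.zero) (parity-∑ℕ g (h ∘ Fin.suc) (f ∘ Fin.suc) (eq ∘ Fin.suc)))
        (sym (ℙ.+-homo-+ (f Fin.zero) (∑ℕ (f ∘ Fin.suc))))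

-- Sums over pairs of list entries

pairSum : (A → A → Parity) → List A → Parity
pairSum h []       = 0ℙ
pairSum h (x ∷ xs) = sumOf (h x) xs ⊕ pairSum h xs

pairSum-++ : ∀ (h : A → A → Parity) xs ys →
             pairSum h (xs ++ ys) ≡ pairSum h xs ⊕ pairSum h ys ⊕ sumOf (λ x → sumOf (h x) ys) xs
pairSum-++ h []       ys = sym (ℙ.+-identityʳ (pairSum h ys))
pairSum-++ h (x ∷ xs) ys = begin
  sumOf (h x) (xs ++ ys) ⊕ pairSum h (xs ++ ys)
    ≡⟨ cong₂ _⊕_ (sumOf-++ (h x) xs ys) (pairSum-++ h xs ys) ⟩
  (sumOf (h x) xs ⊕ sumOf (h x) ys) ⊕ (pairSum h xs ⊕ pairSum h ys ⊕ sumOf (λ x → sumOf (h x) ys) xs)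
    ≡⟨ solve 5 (λ a b c d e → (a :+ b) :+ (c :+ d :+ e) := (a :+ c) :+ d :+ (b :+ e)) refl (sumOf (h x) xs) _ _ _ _ ⟩
  (sumOf (h x) xs ⊕ pairSum h xs) ⊕ pairSum h ys ⊕ (sumOf (h x) ys ⊕ sumOf (λ x → sumOf (h x) ys) xs) ∎

pairSum-map : ∀ (h : A′ → A′ → Parity) (f : A → A′) xs → pairSum h (map f xs) ≡ pairSum (λ x y → h (f x) (f y)) xs
pairSum-map h f []       = refl
pairSum-map h f (x ∷ xs) = cong₂ _⊕_ (sumOf-map (h (f x)) f xs) (pairSum-map h f xs)

pairSum-⊕ : ∀ (h k : A → A → Parity) xs → pairSum (λ x y → h x y ⊕ k x y) xs ≡ pairSum h xs ⊕ pairSum k xs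
pairSum-⊕ h k []       = refl
pairSum-⊕ h k (x ∷ xs) = begin
  sumOf (λ y → h x y ⊕ k x y) xs ⊕ pairSum (λ x y → h x y ⊕ k x y) xs
    ≡⟨ cong₂ _⊕_ (sumOf-⊕ (h x) (k x) xs) (pairSum-⊕ h k xs) ⟩
  (sumOf (h x) xs ⊕ sumOf (k x) xs) ⊕ (pairSum h xs ⊕ pairSum k xs)
    ≡⟨ solve 4 (λ a b c d → (a :+ b) :+ (c :+ d) := (a :+ c) :+ (b :+ d)) refl (sumOf (h x) xs) _ _ _ ⟩
  (sumOf (h x) xs ⊕ pairSum h xs) ⊕ (sumOf (k x) xs ⊕ pairSum k xs) ∎

-- Every element occurs in length xs - 1 pairs.
pairSum-additive : ∀ (g : A → Parity) xs →
                   pairSum (λ x y → g x ⊕ g y) xs ≡ (1ℙ ⊕ parity (length xs)) ⊗ sumOf g xs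
pairSum-additive g []       = refl
pairSum-additive g (x ∷ xs) = begin
  sumOf (λ y → g x ⊕ g y) xs ⊕ pairSum (λ x y → g x ⊕ g y) xs
    ≡⟨ cong₂ _⊕_ (trans (sumOf-⊕ (λ _ → g x) g xs) (cong (_⊕ sumOf g xs) (sumOf-const (g x) xs))) (pairSum-additive g xs) ⟩
  (parity (length xs) ⊗ g x ⊕ sumOf g xs) ⊕ (1ℙ ⊕ parity (length xs)) ⊗ sumOf g xs
    ≡⟨ solve 3 (λ l a s → (l :* a :+ s) :+ (con 1ℙ :+ l) :* s := (con 1ℙ :+ (con 1ℙ :+ l)) :* (a :+ s)) refl (parity (length xs)) (g x) (sumOf g xs) ⟩
  (1ℙ ⊕ (1ℙ ⊕ parity (length xs))) ⊗ (g x ⊕ sumOf g xs)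
    ≡⟨ cong (λ l → (1ℙ ⊕ l) ⊗ (g x ⊕ sumOf g xs)) (parity-suc (length xs)) ⟨
  (1ℙ ⊕ parity (suc (length xs))) ⊗ (g x ⊕ sumOf g xs) ∎

-- The square of a list consists of its diagonal and of the unordered pairs, each met in both
-- orders. Counts for `(x , y)` and `(y , x)` can then be treated together.
sumOf²-pairSum : ∀ (h : A → A → Parity) xs →
                 sumOf (λ x → sumOf (h x) xs) xs ≡ sumOf (λ x → h x x) xs ⊕ pairSum (λ x y → h x y ⊕ h y x) xs
sumOf²-pairSum h []       = refl
sumOf²-pairSum h (x ∷ xs) = begin
  (h x x ⊕ sumOf (h x) xs) ⊕ sumOf (λ z → h z x ⊕ sumOf (h z) xs) xs
    ≡⟨ cong ((h x x ⊕ sumOf (h x) xs) ⊕_) (trans (sumOf-⊕ (λ z → h z x) (λ z → sumOf (h z) xs) xs) (cong (sumOf (λ z → h z x) xs ⊕_) (sumOf²-pairSum h xs))) ⟩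
  (h x x ⊕ sumOf (h x) xs) ⊕ (sumOf (λ z → h z x) xs ⊕ (sumOf (λ z → h z z) xs ⊕ pairSum (λ x y → h x y ⊕ h y x) xs))
    ≡⟨ solve 5 (λ a b c d e → (a :+ b) :+ (c :+ (d :+ e)) := (a :+ d) :+ ((b :+ c) :+ e)) refl (h x x) _ _ _ _ ⟩
  (h x x ⊕ sumOf (λ z → h z z) xs) ⊕ ((sumOf (h x) xs ⊕ sumOf (λ z → h z x) xs) ⊕ pairSum (λ x y → h x y ⊕ h y x) xs)
    ≡⟨ cong (λ s → (h x x ⊕ sumOf (λ z → h z z) xs) ⊕ (s ⊕ _)) (sumOf-⊕ (h x) (λ z → h z x) xs) ⟨
  (h x x ⊕ sumOf (λ z → h z z) xs) ⊕ (sumOf (λ y → h x y ⊕ h y x) xs ⊕ pairSum (λ x y → h x y ⊕ h y x) xs) ∎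

-- Signs of permutations

-- A sign of the derivation, not of the two lists: when entries repeat, different derivations of the
-- same `xs ↭ ys` can have different signs.
sgn : {xs ys : List A} → xs ↭ ys → Parity
sgn ↭.refl        = 0ℙ
sgn (prep x p)    = sgn p
sgn (swap x y p)  = 1ℙ ⊕ sgn p
sgn (↭.trans p q) = sgn p ⊕ sgn q

infix 3 _↭[_]_

_↭[_]_ : List A → Parity → List A → Set
xs ↭[ e ] ys = Σ (xs ↭ ys) λ p → sgn p ≡ e

++⁺ˡ-sgn : ∀ zs {xs ys : List A} {e} → xs ↭[ e ] ys → zs ++ xs ↭[ e ] zs ++ ys
++⁺ˡ-sgn []       p = p
++⁺ˡ-sgn (z ∷ zs) p with q , eq ← ++⁺ˡ-sgn zs p = prep z q , eq

++⁺ʳ-sgn : ∀ {xs ys : List A} zs (p : xs ↭ ys) → xs ++ zs ↭[ sgn p ] ys ++ zs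
++⁺ʳ-sgn zs ↭.refl        = ↭.refl , refl
++⁺ʳ-sgn zs (prep x p)    with q , eq ← ++⁺ʳ-sgn zs p = prep x q , eq
++⁺ʳ-sgn zs (swap x y p)  with q , eq ← ++⁺ʳ-sgn zs p = swap x y q , cong (1ℙ ⊕_) eq
++⁺ʳ-sgn zs (↭.trans p p′) with q , eq ← ++⁺ʳ-sgn zs p | q′ , eq′ ← ++⁺ʳ-sgn zs p′ =
  ↭.trans q q′ , cong₂ _⊕_ eq eq′

++⁺-sgn : ∀ {ws xs ys zs : List A} {e f} → ws ↭[ e ] xs → ys ↭[ f ] zs → ws ++ ys ↭[ e ⊕ f ] xs ++ zs
++⁺-sgn {xs = xs} {ys} (p , refl) q
  with p′ , eq ← ++⁺ʳ-sgn ys p | q′ , eq′ ← ++⁺ˡ-sgn xs q = ↭.trans p′ q′ , cong₂ _⊕_ eq eq′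

-- The last entry passes every other entry once, by one transposition each. This rotation is the
-- source of the sign of a step.
∷ʳ↭∷-sgn : ∀ (xs : List A) x → xs ∷ʳ x ↭[ parity (length xs) ] x ∷ xs
∷ʳ↭∷-sgn []       x = ↭.refl , refl
∷ʳ↭∷-sgn (y ∷ xs) x with p , eq ← ∷ʳ↭∷-sgn xs x =
  ↭.trans (prep y p) (swap y x ↭.refl) ,
  trans (ℙ.+-comm (sgn p) 1ℙ) (trans (cong (1ℙ ⊕_) eq) (sym (parity-suc (length xs))))

Unique-resp-↭ : {xs ys : List A} → xs ↭ ys → Unique xs → Unique ys
Unique-resp-↭ p = ↭ₛ.Unique-resp-↭ (setoid _) (↭.↭⇒↭ₛ p)

-- Detects a descent: the value is `1ℙ` when the second argument is the smaller one, so that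
-- `pairSum lt` counts the inversions of a list.
lt : Fin n → Fin n → Parity
lt x y = if ⌊ y Fin.<? x ⌋ then 1ℙ else 0ℙ

lt-yes : {x y : Fin n} → y Fin.< x → lt x y ≡ 1ℙ
lt-yes {x = x} {y} y<x with y Fin.<? x
... | yes _   = refl
... | no  y≮x = contradiction y<x y≮x

lt-no : {x y : Fin n} → x Fin.≤ y → lt x y ≡ 0ℙ
lt-no {x = x} {y} x≤y with y Fin.<? x
... | yes y<x = contradiction x≤y (ℕ.<⇒≱ y<x)
... | no  _   = refl

lt-flip : {x y : Fin n} → x ≢ y → lt y x ≡ 1ℙ ⊕ lt x y
lt-flip {x = x} {y} x≢y with Fin.<-cmp x y
... | tri< x<y _ _ rewrite lt-yes x<y | lt-no {x = x} {y} (ℕ.<⇒≤ x<y) = refl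
... | tri≈ _ x≡y _ = contradiction x≡y x≢y
... | tri> _ _ y<x rewrite lt-yes y<x | lt-no {x = y} {x} (ℕ.<⇒≤ y<x) = refl

inversions : List (Fin n) → Parity
inversions = pairSum lt

-- A transposition of neighbours with distinct values changes only the contribution of their own
-- pair; the contributions with other entries are sums that ignore order. The map `f` lets one
-- derivation on keys act on rows and columns with the same sign.
inversions-↭ : ∀ (f : A → Fin n) {xs ys} (p : xs ↭ ys) → Unique (map f xs) →
               inversions (map f ys) ≡ sgn p ⊕ inversions (map f xs)
inversions-↭ f ↭.refl u = refl
inversions-↭ f (prep {xs} {ys} x p) (_ ∷ u) = begin
  sumOf (lt (f x)) (map f ys) ⊕ inversions (map f ys)
    ≡⟨ cong₂ _⊕_ (sumOf-↭ (lt (f x)) (↭.map⁺ f (↭-sym p))) (inversions-↭ f p u) ⟩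
  sumOf (lt (f x)) (map f xs) ⊕ (sgn p ⊕ inversions (map f xs))
    ≡⟨ solve 3 (λ a b c → a :+ (b :+ c) := b :+ (a :+ c)) refl (sumOf (lt (f x)) (map f xs)) (sgn p) _ ⟩
  sgn p ⊕ (sumOf (lt (f x)) (map f xs) ⊕ inversions (map f xs)) ∎
inversions-↭ f (swap {xs} {ys} x y p) ((x≢y ∷ _) ∷ _ ∷ u) = begin
  (lt (f y) (f x) ⊕ sumOf (lt (f y)) (map f ys)) ⊕ (sumOf (lt (f x)) (map f ys) ⊕ inversions (map f ys))
    ≡⟨ cong₂ _⊕_ (cong₂ _⊕_ (lt-flip x≢y) (sumOf-↭ (lt (f y)) (↭.map⁺ f (↭-sym p))))
                 (cong₂ _⊕_ (sumOf-↭ (lt (f x)) (↭.map⁺ f (↭-sym p))) (inversions-↭ f p u)) ⟩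
  ((1ℙ ⊕ lt (f x) (f y)) ⊕ sumOf (lt (f y)) (map f xs)) ⊕ (sumOf (lt (f x)) (map f xs) ⊕ (sgn p ⊕ inversions (map f xs)))
    ≡⟨ solve 5 (λ a b c d e → ((con 1ℙ :+ a) :+ b) :+ (c :+ (d :+ e)) := (con 1ℙ :+ d) :+ ((a :+ c) :+ (b :+ e))) refl
         (lt (f x) (f y)) (sumOf (lt (f y)) (map f xs)) (sumOf (lt (f x)) (map f xs)) (sgn p) (inversions (map f xs)) ⟩
  (1ℙ ⊕ sgn p) ⊕ ((lt (f x) (f y) ⊕ sumOf (lt (f x)) (map f xs)) ⊕ (sumOf (lt (f y)) (map f xs) ⊕ inversions (map f xs))) ∎
inversions-↭ f (↭.trans {xs} {ys} {zs} p q) u = begin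
  inversions (map f zs)                         ≡⟨ inversions-↭ f q (Unique-resp-↭ (↭.map⁺ f p) u) ⟩
  sgn q ⊕ inversions (map f ys)                 ≡⟨ cong (sgn q ⊕_) (inversions-↭ f p u) ⟩
  sgn q ⊕ (sgn p ⊕ inversions (map f xs))       ≡⟨ solve 3 (λ a b c → a :+ (b :+ c) := (b :+ a) :+ c) refl (sgn q) (sgn p) _ ⟩
  (sgn p ⊕ sgn q) ⊕ inversions (map f xs)       ∎

unique-↭ : {xs ys : List A} → Unique xs → Unique ys →
           (∀ {x} → x ∈ xs → x ∈ ys) → (∀ {x} → x ∈ ys → x ∈ xs) → xs ↭ ys
unique-↭ u v f g = ∼bag⇒↭ (unique∧set⇒bag u v (mk⇔ f g))

-- Residues, ceilings and translation classes

module Residues (n : ℕ) .{{_ : NonZero n}} where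

  open import Algebra.Properties.AbelianGroup ℤ.+-0-abelianGroup using () renaming (∙-cancelʳ to +-cancelʳ)

  N : ℤ
  N = + n

  private
    negate-remainder : ∀ r q N → - (r + q * N) + N ≡ (N - r) + - q * N
    negate-remainder = solve-∀

  abstract
    ceil : ℤ → ℤ
    ceil x = ⌈ x / n ⌉

    ceil≡ : ∀ x → ⌈ x / n ⌉ ≡ ceil x
    ceil≡ x = refl

    -- If r is the remainder of `- x`, then x is congruent to n - r, a number from 1 to n, and
    -- `opposite` turns the index r into the index n - 1 - r of that representative. Dividing `- x`
    -- matches the definition of the ceiling.
    res : ℤ → Fin n
    res x = opposite (fromℕ< (n%ℕd<d (- x) n))

    rep-res : ∀ x → rep (res x) ≡ N - + ((- x) ℤ.%ℕ n)
    rep-res x = begin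
      + suc (toℕ (res x))                 ≡⟨ cong (λ k → + suc k) (Fin.opposite-prop (fromℕ< r<n)) ⟩
      + suc (n ℕ.∸ suc (toℕ (fromℕ< r<n))) ≡⟨ cong (λ k → + suc (n ℕ.∸ suc k)) (Fin.toℕ-fromℕ< r<n) ⟩
      + suc (n ℕ.∸ suc r)                 ≡⟨ cong +_ (ℕ.+-∸-assoc 1 r<n) ⟨
      + (n ℕ.∸ r)                         ≡⟨ ℤ.⊖-≥ (ℕ.<⇒≤ r<n) ⟨
      n ℤ.⊖ r                             ≡⟨ ℤ.m-n≡m⊖n n r ⟨
      N - + r                             ∎
      where
      r : ℕ
      r = (- x) ℤ.%ℕ n
      r<n : r ℕ.< n
      r<n = n%ℕd<d (- x) n

    -- Division with remainders 1, ..., n. The summand `N` on the left makes the quotient exactly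
    -- `ceil x`, because the block from 1 to n has ceiling 1 and not 0.
    decompose : ∀ x → x + N ≡ rep (res x) + ceil x * N
    decompose x = begin
      x + N                       ≡⟨ cong (_+ N) (ℤ.neg-involutive x) ⟨
      - (- x) + N                 ≡⟨ cong (λ y → - y + N) (a≡a%ℕn+[a/ℕn]*n (- x) n) ⟩
      - (+ r + q * N) + N         ≡⟨ negate-remainder (+ r) q N ⟩
      (N - + r) + - q * N         ≡⟨ cong (_+ - q * N) (rep-res x) ⟨
      rep (res x) + - q * N       ∎
      where
      r : ℕ
      r = (- x) ℤ.%ℕ n
      q : ℤ
      q = (- x) ℤ./ℕ n

  remainder : ∀ x → x ≡ rep (res x) + (ceil x - 1ℤ) * N
  remainder x = begin
    x                                      ≡⟨ add-sub x N ⟩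
    (x + N) - N                            ≡⟨ cong (_- N) (decompose x) ⟩
    (rep (res x) + ceil x * N) - N         ≡⟨ collect (rep (res x)) (ceil x) N ⟩
    rep (res x) + (ceil x - 1ℤ) * N        ∎
    where
    add-sub : ∀ x N → x ≡ (x + N) - N
    add-sub = solve-∀
    collect : ∀ r c N → (r + c * N) - N ≡ r + (c - 1ℤ) * N
    collect = solve-∀

  rep≤n : ∀ (k : Fin n) → rep k ≤ N
  rep≤n k = ℤ.+≤+ (Fin.toℕ<n k)

  rep-mono-< : ∀ {k l : Fin n} → k Fin.< l → rep k < rep l
  rep-mono-< k<l = ℤ.+<+ (ℕ.s<s k<l)

  -- A representative lies between 1 and n, so `rep k + a * N` is at most `(a + 1) * N`, hence at
  -- most `b * N`, and adding `rep l` makes the inequality strict.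
  lex-< : ∀ (k l : Fin n) {a b} → a < b → rep k + a * N < rep l + b * N
  lex-< k l {a} {b} a<b =
    ℤ.≤-<-trans (ℤ.+-monoˡ-≤ (a * N) (rep≤n k)) (ℤ.≤-<-trans
      (subst (_≤ b * N) (ℤ.suc-* a N) (ℤ.*-monoʳ-≤-nonNeg N (ℤ.i<j⇒suc[i]≤j a<b)))
      (subst (_< rep l + b * N) (ℤ.+-identityˡ (b * N)) (ℤ.+-monoˡ-< (b * N) (ℤ.+<+ ℕ.z<s))))

  decompose-unique : ∀ (k l : Fin n) {a b} → rep k + a * N ≡ rep l + b * N → k ≡ l × a ≡ b
  decompose-unique k l {a} {b} eq with ℤ.<-cmp a b
  ... | tri< a<b _ _ = contradiction eq (ℤ.<⇒≢ (lex-< k l a<b))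
  ... | tri> _ _ b<a = contradiction (sym eq) (ℤ.<⇒≢ (lex-< l k b<a))
  ... | tri≈ _ refl _ = Fin.toℕ-injective (ℕ.suc-injective (ℤ.+-injective (+-cancelʳ (a * N) (rep k) (rep l) eq))) , refl

  res-ceil : ∀ x a (k : Fin n) → x + N ≡ rep k + a * N → res x ≡ k × ceil x ≡ a
  res-ceil x a k eq = decompose-unique (res x) k (trans (sym (decompose x)) eq)

  res-ceil-injective : ∀ {x y} → res x ≡ res y → ceil x ≡ ceil y → x ≡ y
  res-ceil-injective {x} {y} r c = +-cancelʳ N x y
    (trans (decompose x) (trans (cong₂ (λ k a → rep k + a * N) r c) (sym (decompose y))))

  private
    decompose-translate : ∀ x k → (x + k * N) + N ≡ rep (res x) + (ceil x + k) * N
    decompose-translate x k = begin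
      (x + k * N) + N                      ≡⟨ swap-last x k N ⟩
      (x + N) + k * N                      ≡⟨ cong (_+ k * N) (decompose x) ⟩
      (rep (res x) + ceil x * N) + k * N   ≡⟨ collect (rep (res x)) (ceil x) k N ⟩
      rep (res x) + (ceil x + k) * N       ∎
      where
      swap-last : ∀ x k N → (x + k * N) + N ≡ (x + N) + k * N
      swap-last = solve-∀
      collect : ∀ r c k N → (r + c * N) + k * N ≡ r + (c + k) * N
      collect = solve-∀

    decompose-rep : ∀ (k : Fin n) → rep k + N ≡ rep k + 1ℤ * N
    decompose-rep k = cong (λ y → rep k + y) (sym (ℤ.*-identityˡ N))

  res-translate : ∀ x k → res (x + k * N) ≡ res x
  res-translate x k = proj₁ (res-ceil (x + k * N) (ceil x + k) (res x) (decompose-translate x k))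

  ceil-translate : ∀ x k → ceil (x + k * N) ≡ ceil x + k
  ceil-translate x k = proj₂ (res-ceil (x + k * N) (ceil x + k) (res x) (decompose-translate x k))

  res≡⇒translate : ∀ {x y} → res x ≡ res y → y ≡ x + (ceil y - ceil x) * N
  res≡⇒translate {x} {y} eq = res-ceil-injective (trans (sym eq) (sym (res-translate x k)))
    (trans (add-sub (ceil x) (ceil y)) (sym (ceil-translate x k)))
    where
    k : ℤ
    k = ceil y - ceil x
    add-sub : ∀ a b → b ≡ a + (b - a)
    add-sub = solve-∀

  res-rep≡ : ∀ k → res (rep k) ≡ k
  res-rep≡ k = proj₁ (res-ceil (rep k) 1ℤ k (decompose-rep k))

  ceil-rep≡ : ∀ k → ceil (rep k) ≡ 1ℤ
  ceil-rep≡ k = proj₂ (res-ceil (rep k) 1ℤ k (decompose-rep k))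

  ∈̄⇒res≡ : ∀ {x} {k : Fin n} → x ∈̄ k → res x ≡ k
  ∈̄⇒res≡ {x} {k} x∈k with divides q eq ← ∣ᵤ⇒∣ {N} {x - rep k} x∈k = proj₁ (res-ceil x (1ℤ + q) k (begin
    x + N                        ≡⟨ regroup x (rep k) N ⟩
    rep k + ((x - rep k) + N)    ≡⟨ cong (λ y → rep k + (y + N)) eq ⟩
    rep k + (q * N + N)          ≡⟨ collect (rep k) q N ⟩
    rep k + (1ℤ + q) * N         ∎))
    where
    regroup : ∀ x r N → x + N ≡ r + ((x - r) + N)
    regroup = solve-∀
    collect : ∀ r q N → r + (q * N + N) ≡ r + (1ℤ + q) * N
    collect = solve-∀

  res-∈̄ : ∀ x → x ∈̄ res x
  res-∈̄ x = ∣⇒∣ᵤ (divides (ceil x - 1ℤ) (trans (cong (_- rep (res x)) (remainder x)) (cancel (rep (res x)) ((ceil x - 1ℤ) * N))))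
    where
    cancel : ∀ r q → (r + q) - r ≡ q
    cancel = solve-∀

  private
    decompose-< : ∀ {x y} → rep (res x) + ceil x * N < rep (res y) + ceil y * N → x < y
    decompose-< {x} {y} lt = ℤ.≰⇒> λ y≤x → ℤ.<⇒≱ lt
      (subst₂ _≤_ (decompose y) (decompose x) (ℤ.+-monoˡ-≤ N y≤x))

  -- Integers are ordered first by block and then by residue within the block; this lemma and the
  -- next three are the two directions of that lexicographic comparison.
  ceil<⇒< : ∀ {x y} → ceil x < ceil y → x < y
  ceil<⇒< {x} {y} c = decompose-< (lex-< (res x) (res y) c)

  res<⇒< : ∀ {x y} → ceil x ≡ ceil y → res x Fin.< res y → x < y
  res<⇒< {x} {y} c r = decompose-<
    (subst (λ a → rep (res x) + a * N < rep (res y) + ceil y * N) (sym c) (ℤ.+-monoˡ-< (ceil y * N) (rep-mono-< r)))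

  <⇒ceil≤ : ∀ {x y} → x < y → ceil x ≤ ceil y
  <⇒ceil≤ x<y = ℤ.≮⇒≥ λ c → ℤ.<-asym x<y (ceil<⇒< c)

  <⇒res< : ∀ {x y} → ceil x ≡ ceil y → x < y → res x Fin.< res y
  <⇒res< {x} {y} c x<y with Fin.<-cmp (res x) (res y)
  ... | tri< r _ _ = r
  ... | tri≈ _ r _ = contradiction x<y (ℤ.<-irrefl (res-ceil-injective r c))
  ... | tri> _ _ r = contradiction x<y (ℤ.<-asym (res<⇒< (sym c) r))

  -- Within one period, the residues descend exactly when a multiple of n is crossed.
  lt-res : ∀ {x y} → x < y → y < x + 1ℤ * N → lt (res x) (res y) ≡ par (ceil x) ⊕ par (ceil y)
  lt-res {x} {y} x<y y<x+n with ℤ.<-cmp (ceil x) (ceil y)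
  ... | tri< c _ _ = begin
    lt (res x) (res y)                ≡⟨ lt-yes (subst (res y Fin.<_) (res-translate x 1ℤ) (<⇒res< (trans cy (sym (ceil-translate x 1ℤ))) y<x+n)) ⟩
    1ℙ                                ≡⟨ solve 1 (λ a → con 1ℙ := a :+ (a :+ con 1ℙ)) refl (par (ceil x)) ⟩
    par (ceil x) ⊕ (par (ceil x) ⊕ 1ℙ) ≡⟨ cong (par (ceil x) ⊕_) (trans (cong par cy) (par-+ (ceil x) 1ℤ)) ⟨
    par (ceil x) ⊕ par (ceil y)       ∎
    where
    cy : ceil y ≡ ceil x + 1ℤ
    -- Since y lies below x + n, its ceiling exceeds that of x by at most one.
    cy = ℤ.≤-antisym (subst (ceil y ≤_) (ceil-translate x 1ℤ) (<⇒ceil≤ y<x+n))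
                     (subst (_≤ ceil y) (ℤ.+-comm 1ℤ (ceil x)) (ℤ.i<j⇒suc[i]≤j c))
  ... | tri≈ _ c _ = trans (lt-no {x = res x} {res y} (ℕ.<⇒≤ (<⇒res< c x<y)))
                           (sym (trans (cong (λ a → par (ceil x) ⊕ par a) (sym c)) (ℙ.p+p≡0ℙ (par (ceil x)))))
  ... | tri> _ _ c = contradiction x<y (ℤ.<-asym (ceil<⇒< c))

  -- A cell up to translation.
  Key : Set
  Key = Fin n × Fin n × ℤ

  key : Cell → Key
  key c = res (row c) , res (col c) , ceil (col c) - ceil (row c)

  key-translate : ∀ k c → key (translate n k c) ≡ key c
  key-translate k (i , j) = cong₂ _,_ (res-translate i k) (cong₂ _,_ (res-translate j k)
    (trans (cong₂ _-_ (ceil-translate j k) (ceil-translate i k)) (cancel (ceil j) (ceil i) k)))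
    where
    cancel : ∀ a b k → (a + k) - (b + k) ≡ a - b
    cancel = solve-∀

  -- The ceilings of the rows determine the amount of the translation; the third component of the
  -- key forces the columns to move by the same amount.
  key≡⇒translate : ∀ {a b} → key a ≡ key b → Translates n a b
  key≡⇒translate {i , j} {i′ , j′} eq = ceil i′ - ceil i , cong₂ _,_
    (res≡⇒translate (cong proj₁ eq))
    (trans (res≡⇒translate (cong (proj₁ ∘ proj₂) eq)) (cong (λ k → j + k * N) (begin
      ceil j′ - ceil j                          ≡⟨ regroup (ceil j′) (ceil j) (ceil i′) ⟩
      (ceil j′ - ceil i′) + (ceil i′ - ceil j)  ≡⟨ cong (_+ (ceil i′ - ceil j)) (cong (proj₂ ∘ proj₂) eq) ⟨
      (ceil j - ceil i) + (ceil i′ - ceil j)    ≡⟨ cancel (ceil j) (ceil i) (ceil i′) ⟩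
      ceil i′ - ceil i                          ∎)))
    where
    regroup : ∀ j′ j i′ → j′ - j ≡ (j′ - i′) + (i′ - j)
    regroup = solve-∀
    cancel : ∀ j i i′ → (j - i) + (i′ - j) ≡ i′ - i
    cancel = solve-∀

-- Lists without repetition and sorted lists

unique-map : ∀ {f : A → A′} {xs} → Unique xs → (∀ {x y} → x ∈ xs → y ∈ xs → f x ≡ f y → x ≡ y) → Unique (map f xs)
unique-map []       inj = []
unique-map (x∉ ∷ u) inj =
  All.map⁺ (All.tabulate λ y∈ fx≡fy → All.lookup x∉ y∈ (inj (here refl) (there y∈) fx≡fy)) ∷
  unique-map u (λ x∈ y∈ → inj (there x∈) (there y∈))

unique-map-factor : ∀ {C : Set} {f : A → A′} {g : A → C} → (∀ {x y} → g x ≡ g y → f x ≡ f y) →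
                    ∀ {xs} → Unique (map f xs) → Unique (map g xs)
unique-map-factor imp u = AllPairs.map⁺ (AllPairs.map (λ fx≢fy gx≡gy → fx≢fy (imp gx≡gy)) (AllPairs.map⁻ u))

unique-++ʳ : ∀ (xs : List A) {ys} → Unique (xs ++ ys) → Unique ys
unique-++ʳ []       u       = u
unique-++ʳ (x ∷ xs) (_ ∷ u) = unique-++ʳ xs u

pairSum-cong : ∀ {R : Rel A 0ℓ} {h k : A → A → Parity} {xs} → (∀ {x y} → R x y → h x y ≡ k x y) →
               AllPairs R xs → pairSum h xs ≡ pairSum k xs
pairSum-cong eq []       = refl
pairSum-cong eq (r ∷ rs) = cong₂ _⊕_ (sumOf-cong-∈ _ (λ y∈ → eq (All.lookup r y∈))) (pairSum-cong eq rs)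

-- If the heads differed, each would occur in the tail of the other list, and so each would precede
-- the other.
sorted-≡ : ∀ {R : Rel A 0ℓ} {xs ys} → Asymmetric R → AllPairs R xs → AllPairs R ys →
           (∀ {x} → x ∈ xs → x ∈ ys) → (∀ {x} → x ∈ ys → x ∈ xs) → xs ≡ ys
sorted-≡ asym []       []       f g = refl
sorted-≡ asym []       (_ ∷ _)  f g with () ← g (here refl)
sorted-≡ asym (_ ∷ _)  []       f g with () ← f (here refl)
sorted-≡ {R = R} asym (_∷_ {x} {xs} r rs) (_∷_ {y} {ys} s ss) f g with x≡y
  where
  x≡y : x ≡ y
  x≡y with f (here refl) | g (here refl)
  ... | here eq  | _         = eq
  ... | there _  | here eq   = sym eq
  ... | there x∈ | there y∈  = contradiction (All.lookup r y∈) (asym (All.lookup s x∈))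
... | refl = cong (x ∷_) (sorted-≡ asym rs ss
  (λ z∈ → tail (f (there z∈)) (All.lookup r z∈)) (λ z∈ → tail (g (there z∈)) (All.lookup s z∈)))
  where
  tail : ∀ {z zs} → z ∈ x ∷ zs → R x z → z ∈ zs
  tail (here refl) r = contradiction r (asym r)
  tail (there z∈)  _ = z∈

last-split : ∀ (cs : List⁺ A) → ∃ λ xs → toList cs ≡ xs ∷ʳ List⁺.last cs
last-split cs with List⁺.snocView cs
... | []       List⁺.∷ʳ′ x = [] , refl
... | (y ∷ ys) List⁺.∷ʳ′ x = y ∷ ys , refl

last-∈ : ∀ (cs : List⁺ A) → List⁺.last cs ∈ toList cs
last-∈ cs with xs , eq ← last-split cs rewrite eq = go xs
  where
  go : ∀ xs {x} → x ∈ xs ∷ʳ x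
  go []       = here refl
  go (_ ∷ xs) = there (go xs)

-- The corners of one level

-- An outer corner takes its row from the later and its column from the earlier of two consecutive
-- balls. Hence the rows miss only the first ball, and the columns, in the next lemma, only the
-- last.
outerCorners-rows : ∀ a cs → map row (outerCorners (a ∷ cs)) ≡ map row cs
outerCorners-rows a []       = refl
outerCorners-rows a (b ∷ cs) = cong (row b ∷_) (outerCorners-rows b cs)

outerCorners-cols : ∀ cs c → map col (outerCorners (cs ∷ʳ c)) ≡ map col cs
outerCorners-cols []           c = refl
outerCorners-cols (a ∷ [])     c = refl
outerCorners-cols (a ∷ b ∷ cs) c = cong (col a ∷_) (outerCorners-cols (b ∷ cs) c)

corners : List⁺ Cell → List Cell
corners cs = backCorner cs ∷ outerCorners (toList cs)

corners-rows : ∀ cs → map row (corners cs) ≡ map row (toList cs)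
corners-rows (c ∷ cs) = cong (row c ∷_) (outerCorners-rows c cs)

-- Passing from the balls to the corners of a level rotates the columns.
corners-cols : ∀ cs → map col (toList cs) ↭[ parity (length (outerCorners (toList cs))) ] map col (corners cs)
corners-cols cs with xs , eq ← last-split cs =
  subst (λ zs → map col zs ↭[ parity (length (outerCorners zs)) ] col x ∷ map col (outerCorners zs)) (sym eq) $
  subst₂ (λ k zs → map col (xs ∷ʳ x) ↭[ parity k ] col x ∷ zs)
    (trans (cong length (sym cols)) (List.length-map col (outerCorners (xs ∷ʳ x)))) (sym cols) $
  subst (_↭[ parity (length (map col xs)) ] col x ∷ map col xs) (sym (List.map-++ col xs (x ∷ [])))
    (∷ʳ↭∷-sgn (map col xs) (col x))
  where
  x = List⁺.last cs
  cols = outerCorners-cols xs x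

module _ (Λ : List (List⁺ Cell)) where

  levelBalls levelCorners : List Cell
  levelBalls   = concatMap toList Λ
  levelCorners = concatMap corners Λ

  levelBacks levelOuters : List Cell
  levelBacks  = map backCorner Λ
  levelOuters = concatMap (outerCorners ∘ toList) Λ

levelCorners-rows : ∀ Λ → map row (levelCorners Λ) ≡ map row (levelBalls Λ)
levelCorners-rows []       = refl
levelCorners-rows (cs ∷ Λ) = begin
  map row (corners cs ++ levelCorners Λ)              ≡⟨ List.map-++ row (corners cs) (levelCorners Λ) ⟩
  map row (corners cs) ++ map row (levelCorners Λ)    ≡⟨ cong₂ _++_ (corners-rows cs) (levelCorners-rows Λ) ⟩
  map row (toList cs) ++ map row (levelBalls Λ)       ≡⟨ List.map-++ row (toList cs) (levelBalls Λ) ⟨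
  map row (toList cs ++ levelBalls Λ)                 ∎

levelCorners-cols : ∀ Λ → map col (levelBalls Λ) ↭[ parity (length (levelOuters Λ)) ] map col (levelCorners Λ)
levelCorners-cols []       = ↭.refl , refl
levelCorners-cols (cs ∷ Λ) =
  subst₂ (λ xs ys → xs ↭[ e ] ys) (sym (List.map-++ col (toList cs) (levelBalls Λ))) (sym (List.map-++ col (corners cs) (levelCorners Λ))) $
  subst (λ e → map col (toList cs) ++ map col (levelBalls Λ) ↭[ e ] map col (corners cs) ++ map col (levelCorners Λ)) e≡
    (++⁺-sgn (corners-cols cs) (levelCorners-cols Λ))
  where
  os = outerCorners (toList cs)
  e = parity (length (os ++ levelOuters Λ))
  e≡ : parity (length os) ⊕ parity (length (levelOuters Λ)) ≡ e
  e≡ = sym (trans (cong parity (List.length-++ os)) (ℙ.+-homo-+ (length os) (length (levelOuters Λ))))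

-- Separates the back corners, which give the top rows of the tabloids, from the balls of fw(w). No
-- sign is recorded: whole cells are moved, so rows and columns change alike.
levelCorners-↭ : ∀ Λ → levelCorners Λ ↭ levelBacks Λ ++ levelOuters Λ
levelCorners-↭ []       = ↭.refl
levelCorners-↭ (cs ∷ Λ) = prep (backCorner cs) $
  ↭-trans (↭.++⁺ˡ os (levelCorners-↭ Λ)) (↭.shifts os (levelBacks Λ))
  where os = outerCorners (toList cs)

-- Crossings, winding and systems of representatives

module Statistics (n : ℕ) .{{_ : NonZero n}} where
  open Residues n public

  crossings : List Cell → Parity
  crossings B = inversions (map (res ∘ row) B) ⊕ inversions (map (res ∘ col) B)

  -- Modulo 2 a difference of ceilings is a sum, so rows and columns can be kept apart and each
  -- rearranged on its own.
  winding : List Cell → Parity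
  winding B = sumOf (par ∘ ceil ∘ row) B ⊕ sumOf (par ∘ ceil ∘ col) B

  winding-key : ∀ B → winding B ≡ sumOf (par ∘ proj₂ ∘ proj₂) (map key B)
  winding-key B = begin
    winding B                                            ≡⟨ sumOf-⊕ (par ∘ ceil ∘ row) (par ∘ ceil ∘ col) B ⟨
    sumOf (λ c → par (ceil (row c)) ⊕ par (ceil (col c))) B
      ≡⟨ sumOf-cong B (λ c → trans (ℙ.+-comm (par (ceil (row c))) _) (sym (par-minus (ceil (col c)) (ceil (row c))))) ⟩
    sumOf (par ∘ proj₂ ∘ proj₂ ∘ key) B                  ≡⟨ sumOf-map (par ∘ proj₂ ∘ proj₂) key B ⟨
    sumOf (par ∘ proj₂ ∘ proj₂) (map key B)              ∎

  crossings-key : ∀ B → crossings B ≡ inversions (map proj₁ (map key B)) ⊕ inversions (map (proj₁ ∘ proj₂) (map key B))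
  crossings-key B = cong₂ (λ xs ys → inversions xs ⊕ inversions ys) (List.map-∘ B) (List.map-∘ B)

  -- A permutation changes the inversions of the rows and of the columns by the same sign.
  crossings-↭ : ∀ {B B′} → map key B ↭ map key B′ → Unique (map (res ∘ row) B) → Unique (map (res ∘ col) B) →
                crossings B ≡ crossings B′
  crossings-↭ {B} {B′} p u v = begin
    crossings B     ≡⟨ crossings-key B ⟩
    inversions (map proj₁ (map key B)) ⊕ inversions (map (proj₁ ∘ proj₂) (map key B))
      ≡⟨ solve 3 (λ s a b → a :+ b := (s :+ a) :+ (s :+ b)) refl (sgn p) (inversions (map proj₁ (map key B))) _ ⟩
    (sgn p ⊕ inversions (map proj₁ (map key B))) ⊕ (sgn p ⊕ inversions (map (proj₁ ∘ proj₂) (map key B)))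
      ≡⟨ cong₂ _⊕_ (inversions-↭ proj₁ p (subst Unique (List.map-∘ B) u)) (inversions-↭ (proj₁ ∘ proj₂) p (subst Unique (List.map-∘ B) v)) ⟨
    inversions (map proj₁ (map key B′)) ⊕ inversions (map (proj₁ ∘ proj₂) (map key B′))
      ≡⟨ crossings-key B′ ⟨
    crossings B′    ∎

  winding-↭ : ∀ {B B′} → map key B ↭ map key B′ → winding B ≡ winding B′
  winding-↭ {B} {B′} p = trans (winding-key B) (trans (sumOf-↭ _ p) (sym (winding-key B′)))

  -- Unlike a permutation of cells, the passage to corners permutes the columns while the rows stay
  -- in place, so the sign of the permutation survives.
  crossings-levelBalls : ∀ Λ → Unique (map (res ∘ col) (levelBalls Λ)) →
    crossings (levelBalls Λ) ≡ parity (length (levelOuters Λ)) ⊕ crossings (levelCorners Λ)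
  crossings-levelBalls Λ u with p , eq ← levelCorners-cols Λ = begin
    inversions (map (res ∘ row) B) ⊕ inversions (map (res ∘ col) B)
      ≡⟨ cong (_⊕ inversions (map (res ∘ col) B)) (cong inversions rows≡) ⟩
    inversions (map (res ∘ row) B′) ⊕ inversions (map (res ∘ col) B)
      -- The sign is inserted twice: one copy turns the columns of the balls into those of the
      -- corners, the other remains as the cost.
      ≡⟨ solve 3 (λ a b s → a :+ b := s :+ (a :+ (s :+ b))) refl (inversions (map (res ∘ row) B′)) (inversions (map (res ∘ col) B)) (sgn p) ⟩
    sgn p ⊕ (inversions (map (res ∘ row) B′) ⊕ (sgn p ⊕ inversions (map (res ∘ col) B)))
      ≡⟨ cong (λ z → sgn p ⊕ (inversions (map (res ∘ row) B′) ⊕ (sgn p ⊕ inversions z))) (List.map-∘ B) ⟩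
    sgn p ⊕ (inversions (map (res ∘ row) B′) ⊕ (sgn p ⊕ inversions (map res (map col B))))
      ≡⟨ cong (λ z → sgn p ⊕ (inversions (map (res ∘ row) B′) ⊕ z)) (inversions-↭ res p (subst Unique (List.map-∘ B) u)) ⟨
    sgn p ⊕ (inversions (map (res ∘ row) B′) ⊕ inversions (map res (map col B′)))
      ≡⟨ cong₂ (λ s z → s ⊕ (inversions (map (res ∘ row) B′) ⊕ inversions z)) eq (sym (List.map-∘ B′)) ⟩
    parity (length (levelOuters Λ)) ⊕ crossings B′ ∎
    where
    B = levelBalls Λ
    B′ = levelCorners Λ
    rows≡ : map (res ∘ row) B ≡ map (res ∘ row) B′
    rows≡ = trans (List.map-∘ B) (trans (cong (map res) (sym (levelCorners-rows Λ))) (sym (List.map-∘ B′)))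

  -- Corners reuse the integer rows and columns of the balls, not merely their residues, so both
  -- sums of ceilings keep their summands.
  winding-levelBalls : ∀ Λ → winding (levelBalls Λ) ≡ winding (levelCorners Λ)
  winding-levelBalls Λ = cong₂ _⊕_
    (trans (sym (sumOf-map (par ∘ ceil) row (levelBalls Λ)))
           (trans (cong (sumOf (par ∘ ceil)) (sym (levelCorners-rows Λ))) (sumOf-map (par ∘ ceil) row (levelCorners Λ))))
    (trans (sym (sumOf-map (par ∘ ceil) col (levelBalls Λ)))
           (trans (sumOf-↭ (par ∘ ceil) (proj₁ (levelCorners-cols Λ))) (sumOf-map (par ∘ ceil) col (levelCorners Λ))))

  -- One ball from each translation class. Uniqueness is demanded of row residues and of column
  -- residues separately, because an inversion parity responds to a permutation by its sign only
  -- when the entries are distinct.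
  record Transversal (w : PartialPerm n) (B : List Cell) : Set where
    field
      sound       : ∀ {c} → c ∈ B → Ball w c
      complete    : ∀ {c} → Ball w c → ∃ λ b → b ∈ B × key b ≡ key c
      rows-unique : Unique (map (res ∘ row) B)
      cols-unique : Unique (map (res ∘ col) B)

    keys-unique : Unique (map key B)
    keys-unique = unique-map-factor (cong proj₁) rows-unique

  module _ {w : PartialPerm n} {B B′ : List Cell} (τ : Transversal w B) (τ′ : Transversal w B′) where
    private
      module τ = Transversal τ
      module τ′ = Transversal τ′

    transversal-↭ : map key B ↭ map key B′
    transversal-↭ = unique-↭ τ.keys-unique τ′.keys-unique (transfer τ τ′) (transfer τ′ τ)
      where
      transfer : ∀ {B B′} → Transversal w B → Transversal w B′ → ∀ {k} → k ∈ map key B → k ∈ map key B′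
      transfer τ τ′ k∈ with c , c∈ , refl ← ∈-map⁻ key k∈
        with b , b∈ , eq ← Transversal.complete τ′ (Transversal.sound τ c∈) = subst (_∈ _) eq (∈-map⁺ key b∈)

    transversal-crossings : crossings B ≡ crossings B′
    transversal-crossings = crossings-↭ transversal-↭ τ.rows-unique τ.cols-unique

    transversal-winding : winding B ≡ winding B′
    transversal-winding = winding-↭ transversal-↭

    transversal-length : length B ≡ length B′
    transversal-length = trans (sym (List.length-map key B)) (trans (↭.↭-length transversal-↭) (List.length-map key B′))

    transversal-rows : map (res ∘ row) B ↭ map (res ∘ row) B′
    transversal-rows = subst₂ _↭_ (sym (List.map-∘ B)) (sym (List.map-∘ B′)) (↭.map⁺ proj₁ transversal-↭)

    transversal-cols : map (res ∘ col) B ↭ map (res ∘ col) B′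
    transversal-cols = subst₂ _↭_ (sym (List.map-∘ B)) (sym (List.map-∘ B′)) (↭.map⁺ (proj₁ ∘ proj₂) transversal-↭)

-- Increasing maps of ℤ and translations

ℤ-induction : ∀ (P : ℤ → Set) → P 0ℤ → (∀ k → P k → P (ℤ.suc k)) → (∀ k → P k → P (ℤ.pred k)) → ∀ k → P k
ℤ-induction P z s p (+ zero)        = z
ℤ-induction P z s p (+ suc k)       = s (+ k) (ℤ-induction P z s p (+ k))
ℤ-induction P z s p -[1+ zero ]     = p 0ℤ z
ℤ-induction P z s p -[1+ suc k ]    = p -[1+ k ] (ℤ-induction P z s p -[1+ k ])

module _ (g : ℤ → ℤ) (mono : ∀ {s t} → s < t → g s < g t) (onto : ∀ t → ∃ λ s → g s ≡ t) where

  -- No value is skipped: a preimage s of `suc (g t)` satisfies t < s, hence `suc t ≤ s`, and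
  -- monotonicity bounds `g (suc t)` from above.
  increasing-onto-suc : ∀ t → g (ℤ.suc t) ≡ ℤ.suc (g t)
  increasing-onto-suc t with s , gs ← onto (ℤ.suc (g t)) =
    ℤ.≤-antisym (subst (g (ℤ.suc t) ≤_) gs (weak (ℤ.i<j⇒suc[i]≤j t<s))) (ℤ.i<j⇒suc[i]≤j (mono (ℤ.suc[i]≤j⇒i<j ℤ.≤-refl)))
    where
    weak : ∀ {s t} → s ≤ t → g s ≤ g t
    weak {s} {t} s≤t with s ℤ.≟ t
    ... | yes refl = ℤ.≤-refl
    ... | no  s≢t  = ℤ.<⇒≤ (mono (ℤ.≤∧≢⇒< s≤t s≢t))
    t<s : t < s
    t<s = ℤ.≰⇒> λ s≤t → ℤ.<⇒≱ (ℤ.suc[i]≤j⇒i<j (ℤ.≤-reflexive (sym gs))) (weak s≤t)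

  increasing-onto-shift : ∀ t → g t ≡ g 0ℤ + t
  increasing-onto-shift = ℤ-induction (λ t → g t ≡ g 0ℤ + t) (sym (ℤ.+-identityʳ (g 0ℤ)))
    (λ t eq → trans (increasing-onto-suc t) (trans (cong ℤ.suc eq) (move (g 0ℤ) t)))
    (λ t eq → trans (back t) (trans (cong ℤ.pred eq) (move′ (g 0ℤ) t)))
    where
    move : ∀ a t → 1ℤ + (a + t) ≡ a + (1ℤ + t)
    move = solve-∀
    move′ : ∀ a t → -1ℤ + (a + t) ≡ a + (-1ℤ + t)
    move′ = solve-∀
    back : ∀ t → g (ℤ.pred t) ≡ ℤ.pred (g t)
    back t = trans (sym (ℤ.pred-suc (g (ℤ.pred t)))) (cong ℤ.pred (trans (sym (increasing-onto-suc (ℤ.pred t))) (cong g (ℤ.suc-pred t))))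

module _ (n : ℕ) where
  private N = + n

  translate-0 : ∀ c → translate n 0ℤ c ≡ c
  translate-0 (i , j) = cong₂ _,_ (ℤ.+-identityʳ i) (ℤ.+-identityʳ j)

  translate-+ : ∀ k l c → translate n k (translate n l c) ≡ translate n (k + l) c
  translate-+ k l (i , j) = cong₂ _,_ (assoc i k l N) (assoc j k l N)
    where
    assoc : ∀ i k l N → i + l * N + k * N ≡ i + (k + l) * N
    assoc = solve-∀

  translate-inverse : ∀ k l c → k + l ≡ 0ℤ → translate n k (translate n l c) ≡ c
  translate-inverse k l c eq = trans (translate-+ k l c) (trans (cong (λ z → translate n z c) eq) (translate-0 c))

  translate-NW : ∀ k {a b} → a StrictlyNorthWestOf b → translate n k a StrictlyNorthWestOf translate n k b
  translate-NW k (r , c) = ℤ.+-monoˡ-< (k * N) r , ℤ.+-monoˡ-< (k * N) c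

NW-trans : ∀ {a b c} → a StrictlyNorthWestOf b → b StrictlyNorthWestOf c → a StrictlyNorthWestOf c
NW-trans (r , c) (r′ , c′) = ℤ.<-trans r r′ , ℤ.<-trans c c′

module Balls {n : ℕ} (w : PartialPerm n) where
  open PartialPerm w
  private
    N = + n
    T = translate n

  private
    sub-add : ∀ i N → i ≡ i - N + N
    sub-add = solve-∀
    add-sub : ∀ i N → i ≡ i + N - N
    add-sub = solve-∀

  Ball-suc : ∀ {i j} → fun i ≡ just j → fun (i + N) ≡ just (j + N)
  Ball-suc {i} eq rewrite periodic i | eq = refl

  -- Periodicity is given for steps by n upwards. Applied at `i - N`, it shows that w is defined
  -- there, since otherwise w would be undefined at i.
  Ball-pred : ∀ {i j} → fun i ≡ just j → fun (i - N) ≡ just (j - N)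
  Ball-pred {i} {j} eq with fun (i - N) | periodic (i - N)
  ... | nothing | per with () ← trans (sym eq) (trans (cong fun (sub-add i N)) per)
  ... | just j′ | per = cong just (trans (add-sub j′ N) (cong (_- N) (sym (just-injective (trans (sym eq) (trans (cong fun (sub-add i N)) per))))))

  Ball-translate : ∀ k {c} → Ball w c → Ball w (T k c)
  Ball-translate k {c@(i , j)} b = ℤ-induction (λ k → Ball w (T k c))
    (subst (Ball w) (sym (translate-0 n c)) b)
    (λ k b → subst (Ball w) (cong₂ _,_ (up i k N) (up j k N)) (Ball-suc b))
    (λ k b → subst (Ball w) (cong₂ _,_ (down i k N) (down j k N)) (Ball-pred b))
    k
    where
    up : ∀ i k N → i + k * N + N ≡ i + (1ℤ + k) * N
    up = solve-∀
    down : ∀ i k N → i + k * N - N ≡ i + (-1ℤ + k) * N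
    down = solve-∀

  Ball-row : ∀ {a b} → Ball w a → Ball w b → row a ≡ row b → a ≡ b
  Ball-row {i , j} {.i , j′} p q refl = cong (i ,_) (just-injective (trans (sym p) q))

  Ball-col : ∀ {a b} → Ball w a → Ball w b → col a ≡ col b → a ≡ b
  Ball-col {i , j} {i′ , .j} p q refl = cong (_, j) (injective p q)

  -- Distinct balls share neither a row nor a column, so a weak comparison between them is strict in
  -- both coordinates.
  Ball-NW : ∀ {a b} → Ball w a → Ball w b → a NorthWestOf b → a ≡ b ⊎ a StrictlyNorthWestOf b
  Ball-NW {a} {b} p q (r , c) with row a ℤ.≟ row b | col a ℤ.≟ col b
  ... | yes eq | _      = inj₁ (Ball-row p q eq)
  ... | no  _  | yes eq = inj₁ (Ball-col p q eq)
  ... | no r≢  | no c≢  = inj₂ (ℤ.≤∧≢⇒< r r≢ , ℤ.≤∧≢⇒< c c≢)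

  Path-translate : ∀ k {b l c} → Path w b l c → Path w (T k b) l (T k c)
  Path-translate k (stop b)       = stop (Ball-translate k b)
  Path-translate k (step b b′ p)  = step (Ball-translate k b) (translate-NW n k b′) (Path-translate k p)

-- The numbering of a stream and the numbering it induces on all balls

module Numbering {n : ℕ} .{{_ : NonZero n}} {w : PartialPerm n} {C : Pred Cell 0ℓ} (isStream : IsStream w C)
                 {d̃ : Cell → ℤ} (isNumbering : IsNumbering C d̃)
                 {d : Cell → ℤ} (d-max : ∀ {b} → Ball w b → IsMaxPathValue w C d̃ b (d b)) where
  open IsStream isStream
  open IsNumbering isNumbering
  open Balls w
  private
    N = + n
    T = translate n
    c : ℤ → Cell
    c t = proj₁ (consecutive t)
    c∈C : ∀ t → C (c t)
    c∈C t = proj₁ (proj₂ (consecutive t))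
    d̃c : ∀ t → d̃ (c t) ≡ t
    d̃c t = proj₂ (proj₂ (consecutive t))

  stream-NW : ∀ {a b} → C a → C b → d̃ a < d̃ b → a StrictlyNorthWestOf b
  stream-NW a∈ b∈ lt with total a∈ b∈
  ... | inj₁ nw with Ball-NW (balls a∈) (balls b∈) nw
  ...   | inj₁ refl = contradiction lt (ℤ.<-irrefl refl)
  ...   | inj₂ snw  = snw
  stream-NW a∈ b∈ lt | inj₂ nw with Ball-NW (balls b∈) (balls a∈) nw
  ...   | inj₁ refl = contradiction lt (ℤ.<-irrefl refl)
  ...   | inj₂ snw  = contradiction lt (ℤ.<-asym (increasing b∈ a∈ snw))

  d̃-injective : ∀ {a b} → C a → C b → d̃ a ≡ d̃ b → a ≡ b
  d̃-injective a∈ b∈ eq with total a∈ b∈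
  ... | inj₁ nw with Ball-NW (balls a∈) (balls b∈) nw
  ...   | inj₁ a≡b = a≡b
  ...   | inj₂ snw = contradiction (increasing a∈ b∈ snw) (ℤ.<-irrefl eq)
  d̃-injective a∈ b∈ eq | inj₂ nw with Ball-NW (balls b∈) (balls a∈) nw
  ...   | inj₁ b≡a = sym b≡a
  ...   | inj₂ snw = contradiction (increasing b∈ a∈ snw) (ℤ.<-irrefl (sym eq))

  private
    -- Translation by (n,n) read through the numbering: the number of the translate of the ball
    -- numbered t. It is increasing and onto, and therefore a shift.
    g : ℤ → ℤ
    g t = d̃ (T 1ℤ (c t))

    g-mono : ∀ {s t} → s < t → g s < g t
    g-mono {s} {t} s<t = increasing (invariant 1ℤ (c∈C s)) (invariant 1ℤ (c∈C t))
      (translate-NW n 1ℤ (stream-NW (c∈C s) (c∈C t) (subst₂ _<_ (sym (d̃c s)) (sym (d̃c t)) s<t)))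

    g-onto : ∀ t → ∃ λ s → g s ≡ t
    g-onto t = d̃ a , (begin
      d̃ (T 1ℤ (c (d̃ a)))   ≡⟨ cong (d̃ ∘ T 1ℤ) (d̃-injective (c∈C (d̃ a)) a∈ (d̃c (d̃ a))) ⟩
      d̃ (T 1ℤ a)           ≡⟨ cong d̃ (translate-inverse n 1ℤ -1ℤ (c t) refl) ⟩
      d̃ (c t)              ≡⟨ d̃c t ⟩
      t                    ∎)
      where
      a = T -1ℤ (c t)
      a∈ = invariant -1ℤ (c∈C t)

    g-0 : 0ℤ < g 0ℤ
    g-0 = subst (_< g 0ℤ) (d̃c 0ℤ) (increasing (c∈C 0ℤ) (invariant 1ℤ (c∈C 0ℤ)) (grow (row (c 0ℤ)) , grow (col (c 0ℤ))))
      where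
      grow : ∀ i → i < i + 1ℤ * N
      grow i = subst₂ _<_ (ℤ.+-identityʳ i) (cong (λ y → i + y) (sym (ℤ.*-identityˡ N))) (ℤ.+-monoʳ-< i (ℤ.+<+ (ℕ.>-nonZero⁻¹ n)))

    d̃-shift : ∀ {a} → C a → d̃ (T 1ℤ a) ≡ g 0ℤ + d̃ a
    d̃-shift {a} a∈ = trans (cong (d̃ ∘ T 1ℤ) (sym (d̃-injective (c∈C (d̃ a)) a∈ (d̃c (d̃ a))))) (increasing-onto-shift g g-mono g-onto (d̃ a))

  -- The shift is positive because the translate lies strictly southeast. Writing it as `suc m`
  -- exhibits this, as residues of levels modulo the shift require.
  period-∃ : ∃ λ m → ∀ {a} → C a → d̃ (T 1ℤ a) ≡ + suc m + d̃ a
  period-∃ with g 0ℤ | g-0 | (λ {a} → d̃-shift {a})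
  ... | + suc m | _ | shift = m , shift
  ... | + zero  | ℤ.+<+ () | _

  -- A path from b may begin with a step to a and continue along an optimal path of a, which makes
  -- it longer by one.
  d-mono : ∀ {a b} → Ball w a → Ball w b → a StrictlyNorthWestOf b → d a < d b
  d-mono {a} {b} p q snw with IsMaxPathValue.attained (d-max p)
  ... | k , c , path , c∈ , eq = ℤ.suc[i]≤j⇒i<j (subst (_≤ d b) (trans (move (d̃ c) (+ k)) (cong ℤ.suc (sym eq)))
      (IsMaxPathValue.bound (d-max q) (step q snw path) c∈))
    where
    move : ∀ a k → a + (1ℤ + k) ≡ 1ℤ + (a + k)
    move = solve-∀

  d̃≤d : ∀ {a} → C a → d̃ a ≤ d a
  d̃≤d {a} a∈ = subst (_≤ d a) (ℤ.+-identityʳ (d̃ a)) (IsMaxPathValue.bound (d-max (balls a∈)) (stop (balls a∈)) a∈)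

  Path-ball : ∀ {b k c} → Path w b k c → Ball w b
  Path-ball (stop b)     = b
  Path-ball (step b _ _) = b

  private
    ≤t : ∀ {a b t} → d b ≡ ℤ.suc t → Ball w a → Ball w b → a StrictlyNorthWestOf b → d a ≤ t
    ≤t {a} {b} {t} db p q snw = subst (d a ≤_) (ℤ.pred-suc t) (ℤ.i<j⇒i≤pred[j] (subst (d a <_) db (d-mono p q snw)))

  -- If an optimal path from b has a step, its second ball is the wanted one. If it has none, b is
  -- in the channel with number `suc t`, and the channel ball numbered t serves. In both cases
  -- `d-mono` gives the upper bound on the level, and maximality of d over paths gives the lower
  -- one.
  predecessor : ∀ {b t} → Ball w b → d b ≡ ℤ.suc t → ∃ λ a → Ball w a × d a ≡ t × a StrictlyNorthWestOf b
  predecessor {b} {t} ball db with IsMaxPathValue.attained (d-max ball)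
  ... | zero , .b , stop _ , b∈ , eq = a , balls a∈ , ℤ.≤-antisym (≤t db (balls a∈) ball snw) (subst (_≤ d a) (d̃c t) (d̃≤d a∈)) , snw
    where
    a = c t
    a∈ = c∈C t
    snw : a StrictlyNorthWestOf b
    snw = stream-NW a∈ b∈ (subst₂ _<_ (sym (d̃c t)) (trans (sym db) (trans eq (ℤ.+-identityʳ (d̃ b)))) (ℤ.suc[i]≤j⇒i<j ℤ.≤-refl))
  ... | suc k , e , step _ snw path , e∈ , eq = _ , Path-ball path , ℤ.≤-antisym (≤t db (Path-ball path) ball snw) lower , snw
    where
    move : ∀ a k → a + k ≡ -1ℤ + (a + (1ℤ + k))
    move = solve-∀
    lower : t ≤ d _
    lower = subst (_≤ d _) (trans (move (d̃ e) (+ k)) (trans (cong ℤ.pred (trans (sym eq) db)) (ℤ.pred-suc t)))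
      (IsMaxPathValue.bound (d-max (Path-ball path)) path e∈)

  module Period {m : ℕ} (d̃-shift : ∀ {a} → C a → d̃ (T 1ℤ a) ≡ + m + d̃ a) where
    private
      M = + m

      d̃-unshift : ∀ {a} → C a → d̃ (T -1ℤ a) ≡ d̃ a - M
      d̃-unshift {a} a∈ = begin
        d̃ (T -1ℤ a)                ≡⟨ cancel (d̃ (T -1ℤ a)) M ⟩
        (M + d̃ (T -1ℤ a)) - M      ≡⟨ cong (_- M) (d̃-shift (invariant -1ℤ a∈)) ⟨
        d̃ (T 1ℤ (T -1ℤ a)) - M     ≡⟨ cong (λ z → d̃ z - M) (translate-inverse n 1ℤ -1ℤ a refl) ⟩
        d̃ a - M                    ∎
        where
        cancel : ∀ a M → a ≡ (M + a) - M
        cancel = solve-∀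

    -- Translating a path by n in either direction keeps its length and changes the number of its
    -- end by m, so the maxima correspond.
    d-shift : ∀ {b} → Ball w b → d (T 1ℤ b) ≡ M + d b
    d-shift {b} ball = ℤ.≤-antisym upper lower
      where
      lower : M + d b ≤ d (T 1ℤ b)
      lower with IsMaxPathValue.attained (d-max ball)
      ... | k , a , path , a∈ , eq = subst (_≤ d (T 1ℤ b))
        (trans (cong (_+ + k) (d̃-shift a∈)) (trans (ℤ.+-assoc M (d̃ a) (+ k)) (cong (λ y → M + y) (sym eq))))
        (IsMaxPathValue.bound (d-max (Ball-translate 1ℤ ball)) (Path-translate 1ℤ path) (invariant 1ℤ a∈))
      upper : d (T 1ℤ b) ≤ M + d b
      upper with IsMaxPathValue.attained (d-max (Ball-translate 1ℤ ball))
      ... | k , a , path , a∈ , eq = subst (_≤ M + d b)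
        (trans (cong (λ y → M + (y + + k)) (d̃-unshift a∈)) (trans (cancel M (d̃ a) (+ k)) (sym eq)))
        (ℤ.+-monoʳ-≤ M (IsMaxPathValue.bound (d-max ball)
          (subst (λ z → Path w z k (T -1ℤ a)) (translate-inverse n -1ℤ 1ℤ b refl) (Path-translate -1ℤ path)) (invariant -1ℤ a∈)))
        where
        cancel : ∀ M a k → M + ((a - M) + k) ≡ a + k
        cancel = solve-∀

    d-translate : ∀ k {b} → Ball w b → d (T k b) ≡ d b + k * M
    d-translate k {b} ball = ℤ-induction (λ k → d (T k b) ≡ d b + k * M)
      (trans (cong d (translate-0 n b)) (sym (ℤ.+-identityʳ (d b))))
      (λ k eq → begin
        d (T (ℤ.suc k) b)    ≡⟨ cong d (translate-+ n 1ℤ k b) ⟨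
        d (T 1ℤ (T k b))     ≡⟨ d-shift (Ball-translate k ball) ⟩
        M + d (T k b)        ≡⟨ cong (λ y → M + y) eq ⟩
        M + (d b + k * M)    ≡⟨ up (d b) k M ⟩
        d b + ℤ.suc k * M    ∎)
      (λ k eq → begin
        d (T (ℤ.pred k) b)                ≡⟨ cancel (d (T (ℤ.pred k) b)) M ⟩
        (M + d (T (ℤ.pred k) b)) - M      ≡⟨ cong (_- M) (d-shift (Ball-translate (ℤ.pred k) ball)) ⟨
        d (T 1ℤ (T (ℤ.pred k) b)) - M     ≡⟨ cong (λ z → d z - M) (translate-+ n 1ℤ (ℤ.pred k) b) ⟩
        d (T (ℤ.suc (ℤ.pred k)) b) - M    ≡⟨ cong (λ z → d (T z b) - M) (ℤ.suc-pred k) ⟩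
        d (T k b) - M                     ≡⟨ cong (_- M) eq ⟩
        (d b + k * M) - M                 ≡⟨ down (d b) k M ⟩
        d b + ℤ.pred k * M                ∎) k
      where
      up : ∀ a k M → M + (a + k * M) ≡ a + (1ℤ + k) * M
      up = solve-∀
      cancel : ∀ a M → a ≡ (M + a) - M
      cancel = solve-∀
      down : ∀ a k M → (a + k * M) - M ≡ a + (-1ℤ + k) * M
      down = solve-∀

-- Levels and corners of one step

allPairs-last : ∀ {R : Rel A 0ℓ} xs {x y} → AllPairs R (xs ∷ʳ x) → y ∈ xs ∷ʳ x → y ≡ x ⊎ R y x
allPairs-last []       _        (here eq)    = inj₁ eq
allPairs-last (z ∷ xs) (r ∷ _)  (here refl)  = inj₂ (All.lookup r (∈-++⁺ʳ xs (here refl)))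
allPairs-last (z ∷ xs) (_ ∷ rs) (there y∈)   = allPairs-last xs rs y∈

outerCorners-translate : ∀ n k cs → outerCorners (map (translate n k) cs) ≡ map (translate n k) (outerCorners cs)
outerCorners-translate n k []           = refl
outerCorners-translate n k (a ∷ [])     = refl
outerCorners-translate n k (a ∷ b ∷ cs) = cong (_ ∷_) (outerCorners-translate n k (b ∷ cs))

backCorner-translate : ∀ n k cs cs′ → toList cs′ ≡ map (translate n k) (toList cs) →
                       backCorner cs′ ≡ translate n k (backCorner cs)
backCorner-translate n k cs cs′ eq
  with xs , split ← last-split cs | xs′ , split′ ← last-split cs′ = cong₂ _,_
    (cong row (List.∷-injectiveˡ eq))
    (cong col (List.∷ʳ-injectiveʳ xs′ (map (translate n k) xs) (begin
      xs′ ∷ʳ List⁺.last cs′                                ≡⟨ split′ ⟨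
      toList cs′                                           ≡⟨ eq ⟩
      map (translate n k) (toList cs)                      ≡⟨ cong (map (translate n k)) split ⟩
      map (translate n k) (xs ∷ʳ List⁺.last cs)            ≡⟨ List.map-++ (translate n k) xs _ ⟩
      map (translate n k) xs ∷ʳ translate n k (List⁺.last cs) ∎)))

module Levels {n : ℕ} .{{_ : NonZero n}} {w : PartialPerm n} {p q : Subset n} {l : ℕ} {r : ℤ} {w′ : PartialPerm n}
              (σ : Step w p q l r w′) (m : ℕ) .{{_ : NonZero m}}
              (d̃-shift : ∀ {a} → Step.C σ a → Step.d̃ σ (translate n 1ℤ a) ≡ + m + Step.d̃ σ a) where
  open Step σ
  open Balls w
  open Numbering (IsChannel.isStream (IsSouthWestChannel.isChannel C-southWest)) d̃-numbering d-max
  open Period d̃-shift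
  open Statistics n
  private
    T = translate n
    M = + m
    -- Two moduli occur: n for rows and columns, and the period m for levels.
    module M = Residues m

  level-ball : ∀ {t c} → c ∈ toList (level t) → Ball w c
  level-ball c∈ = proj₁ (Equivalence.to (level-balls _ _) c∈)

  level-d : ∀ {t c} → c ∈ toList (level t) → d c ≡ t
  level-d c∈ = proj₂ (Equivalence.to (level-balls _ _) c∈)

  ball-level : ∀ {t c} → Ball w c → d c ≡ t → c ∈ toList (level t)
  ball-level b eq = Equivalence.from (level-balls _ _) (b , eq)

  level-increasing : ∀ t → AllPairs (λ a b → row a < row b) (toList (level t))
  level-increasing t = Linked⇒AllPairs ℤ.<-trans (level-sorted t)

  -- Both lists are sorted by row and contain the same balls, because translating by k periods
  -- raises d by `k * M`.
  level-translate : ∀ k t → toList (level (t + k * M)) ≡ map (T k) (toList (level t))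
  level-translate k t = sorted-≡ ℤ.<-asym (level-increasing (t + k * M))
    (AllPairs.map⁺ (AllPairs.map (ℤ.+-monoˡ-< (k * + n)) (level-increasing t))) to from
    where
    cancel : ∀ t k M → t + k * M + - k * M ≡ t
    cancel = solve-∀
    to : ∀ {c} → c ∈ toList (level (t + k * M)) → c ∈ map (T k) (toList (level t))
    to {c} c∈ = subst (_∈ _) (translate-inverse n k (- k) c (ℤ.+-inverseʳ k)) (∈-map⁺ (T k)
      (ball-level (Ball-translate (- k) (level-ball c∈))
        (trans (d-translate (- k) (level-ball c∈)) (trans (cong (_+ - k * M) (level-d c∈)) (cancel t k M)))))
    from : ∀ {c} → c ∈ map (T k) (toList (level t)) → c ∈ toList (level (t + k * M))
    from c∈ with b , b∈ , refl ← ∈-map⁻ (T k) c∈ =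
      ball-level (Ball-translate k (level-ball b∈)) (trans (d-translate k (level-ball b∈)) (cong (_+ k * M) (level-d b∈)))

  back : ℤ → Cell
  back t = backCorner (level t)

  outer : ℤ → List Cell
  outer t = outerCorners (toList (level t))

  back-translate : ∀ k t → back (t + k * M) ≡ T k (back t)
  back-translate k t = backCorner-translate n k (level t) (level (t + k * M)) (level-translate k t)

  outer-translate : ∀ k t → outer (t + k * M) ≡ map (T k) (outer t)
  outer-translate k t = trans (cong outerCorners (level-translate k t)) (outerCorners-translate n k (toList (level t)))

  back-row-min : ∀ {t c} → c ∈ toList (level t) → row (back t) ≤ row c
  back-row-min {t} c∈ = go (level t) (level-increasing t) c∈
    where
    go : ∀ cs → AllPairs (λ a b → row a < row b) (toList cs) → ∀ {c} → c ∈ toList cs → row (List⁺.head cs) ≤ row c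
    go (a ∷ cs) _       (here refl) = ℤ.≤-refl
    go (a ∷ cs) (r ∷ _) (there c∈)  = ℤ.<⇒≤ (All.lookup r c∈)

  -- A level is an antichain, so its lowest ball is also its westernmost one.
  back-col-min : ∀ {t c} → c ∈ toList (level t) → col (back t) ≤ col c
  back-col-min {t} {c} c∈ with xs , split ← last-split (level t)
    with allPairs-last xs (subst (AllPairs _) split (level-increasing t)) (subst (c ∈_) split c∈)
  ... | inj₁ refl = ℤ.≤-refl
  ... | inj₂ r    = ℤ.≮⇒≥ λ lt → ℤ.<-irrefl (trans (level-d c∈) (sym (level-d z∈))) (d-mono (level-ball c∈) (level-ball z∈) (r , lt))
    where
    z∈ : List⁺.last (level t) ∈ toList (level t)
    z∈ = last-∈ (level t)

  -- The row of a back corner is the row of a ball of its level, and its column is the column of a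
  -- possibly different one. Each of these has a ball of the previous level strictly to its
  -- northwest, whose coordinates are bounded below by those of the previous back corner.
  back-suc : ∀ t → back t StrictlyNorthWestOf back (ℤ.suc t)
  back-suc t = below (here refl) proj₁ back-row-min , below (last-∈ (level (ℤ.suc t))) proj₂ back-col-min
    where
    below : ∀ {b} {f : Cell → ℤ} → b ∈ toList (level (ℤ.suc t)) → (∀ {a} → a StrictlyNorthWestOf b → f a < f b) →
            (∀ {a} → a ∈ toList (level t) → f (back t) ≤ f a) → f (back t) < f b
    below b∈ lt le with a , ball , da , snw ← predecessor (level-ball b∈) (level-d b∈) =
      ℤ.≤-<-trans (le (ball-level ball da)) (lt snw)

  back-mono : ∀ {s t} → s < t → back s StrictlyNorthWestOf back t
  back-mono {s} {t} s<t = subst (back s StrictlyNorthWestOf_)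
    (cong back (trans (cong (λ k → ℤ.suc k + s) (ℤ.0≤i⇒+∣i∣≡i (ℤ.i≤j⇒0≤j-i (ℤ.i<j⇒suc[i]≤j s<t)))) (cancel s t)))
    (go ∣ t - ℤ.suc s ∣)
    where
    cancel : ∀ s t → (1ℤ + (t - (1ℤ + s))) + s ≡ t
    cancel = solve-∀
    go : ∀ k → back s StrictlyNorthWestOf back (+ suc k + s)
    go zero    = back-suc s
    go (suc k) = NW-trans {b = back (+ suc k + s)} (go k)
      (subst (λ z → back (+ suc k + s) StrictlyNorthWestOf back z) (sym (ℤ.+-assoc 1ℤ (+ suc k) s)) (back-suc (+ suc k + s)))

  back-injective : ∀ {s t} → back s ≡ back t → s ≡ t
  back-injective {s} {t} eq with ℤ.<-cmp s t
  ... | tri< s<t _ _ = contradiction (proj₁ (back-mono s<t)) (ℤ.<-irrefl (cong row eq))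
  ... | tri≈ _ s≡t _ = s≡t
  ... | tri> _ _ t<s = contradiction (proj₁ (back-mono t<s)) (ℤ.<-irrefl (cong row (sym eq)))

  period-unique : ∀ {i j : Fin m} k → rep j ≡ rep i + k * M → i ≡ j × k ≡ 0ℤ
  period-unique {i} {j} k eq = M.decompose-unique i j (trans (sym eq) (sym (ℤ.+-identityʳ (rep j))))

  -- The levels 1, ..., m. Translation raises the level by m, so every translation class of balls is
  -- met here exactly once.
  Λ : List (List⁺ Cell)
  Λ = tabulate λ (i : Fin m) → level (rep i)

  ∈-tabulate-concatMap⁻ : ∀ (f : List⁺ Cell → List Cell) {c} → c ∈ concatMap f Λ → ∃ λ i → c ∈ f (level (rep i))
  ∈-tabulate-concatMap⁻ f c∈ with cs , cs∈ , c∈cs ← find (∈-concatMap⁻ f {xs = Λ} c∈)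
    with i , refl ← ∈-tabulate⁻ cs∈ = i , c∈cs

  ∈-tabulate-concatMap⁺ : ∀ (f : List⁺ Cell → List Cell) {c} i → c ∈ f (level (rep i)) → c ∈ concatMap f Λ
  ∈-tabulate-concatMap⁺ f i c∈ = ∈-concatMap⁺ f {xs = Λ} (lose (∈-tabulate⁺ i) c∈)

  balls-unique : Unique (levelBalls Λ)
  balls-unique = Unique.concat⁺
    (All.map⁺ (All.tabulate⁺ λ i → AllPairs.map (λ lt → λ { refl → ℤ.<-irrefl refl lt }) (level-increasing (rep i))))
    (AllPairs.map⁺ (AllPairs.tabulate⁺ λ i≢j → λ (c∈ , c∈′) →
      i≢j (proj₁ (period-unique 0ℤ (trans (trans (sym (level-d c∈′)) (level-d c∈)) (sym (ℤ.+-identityʳ _)))))))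

  -- The level detects the translation: moving by k periods adds `k * M`, which stays within 1, ...,
  -- m only for k = 0.
  balls-injective : ∀ {a b} k → a ∈ levelBalls Λ → b ∈ levelBalls Λ → b ≡ T k a → a ≡ b
  balls-injective {a} {b} k a∈ b∈ eq =
    trans (sym (translate-0 n a)) (trans (cong (λ z → T z a) (sym k≡0)) (sym eq))
    where
    i,a∈ : ∃ λ i → a ∈ toList (level (rep i))
    i,a∈ = ∈-tabulate-concatMap⁻ toList a∈
    j,b∈ : ∃ λ j → b ∈ toList (level (rep j))
    j,b∈ = ∈-tabulate-concatMap⁻ toList b∈
    k≡0 : k ≡ 0ℤ
    k≡0 = proj₂ (period-unique k (begin
      rep (proj₁ j,b∈)           ≡⟨ level-d (proj₂ j,b∈) ⟨
      d b                        ≡⟨ cong d eq ⟩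
      d (T k a)                  ≡⟨ d-translate k (level-ball (proj₂ i,a∈)) ⟩
      d a + k * M                ≡⟨ cong (_+ k * M) (level-d (proj₂ i,a∈)) ⟩
      rep (proj₁ i,a∈) + k * M   ∎))

  private
    levelBalls-ball : ∀ {c} → c ∈ levelBalls Λ → Ball w c
    levelBalls-ball c∈ = level-ball (proj₂ (∈-tabulate-concatMap⁻ toList c∈))

  balls-transversal : Transversal w (levelBalls Λ)
  balls-transversal = record
    { sound       = levelBalls-ball
    ; complete    = complete′
    -- Equal residues put b into the row of a translate of a, and a row holds only one ball.
    ; rows-unique = unique-map balls-unique λ {a} {b} a∈ b∈ eq → let k = ceil (row b) - ceil (row a) in balls-injective k a∈ b∈
        (Ball-row (levelBalls-ball b∈) (Ball-translate k (levelBalls-ball a∈)) (res≡⇒translate eq))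
    ; cols-unique = unique-map balls-unique λ {a} {b} a∈ b∈ eq → let k = ceil (col b) - ceil (col a) in balls-injective k a∈ b∈
        (Ball-col (levelBalls-ball b∈) (Ball-translate k (levelBalls-ball a∈)) (res≡⇒translate eq))
    }
    where
    cancel : ∀ r k M → r + k * M + - k * M ≡ r
    cancel = solve-∀
    complete′ : ∀ {c} → Ball w c → ∃ λ b → b ∈ levelBalls Λ × key b ≡ key c
    complete′ {c} ball = T (- k) c , ∈-tabulate-concatMap⁺ toList i (ball-level (Ball-translate (- k) ball)
        (trans (d-translate (- k) ball) (trans (cong (_+ - k * M) (M.remainder (d c))) (cancel (rep i) k M))))
      , key-translate (- k) c
      where
      i = M.res (d c)
      k = M.ceil (d c) - 1ℤ

  private
    B F S′ : List Cell
    B = levelBalls Λ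
    F = levelOuters Λ
    S′ = levelBacks Λ

    module B = Transversal balls-transversal

  rows-↭ : map (res ∘ row) B ↭ map (res ∘ row) (S′ ++ F)
  rows-↭ = ↭-trans (↭.↭-reflexive (trans (List.map-∘ B) (trans (cong (map res) (sym (levelCorners-rows Λ))) (sym (List.map-∘ (levelCorners Λ))))))
                   (↭.map⁺ (res ∘ row) (levelCorners-↭ Λ))

  cols-↭ : map (res ∘ col) B ↭ map (res ∘ col) (S′ ++ F)
  cols-↭ = ↭-trans (subst₂ _↭_ (sym (List.map-∘ B)) (sym (List.map-∘ (levelCorners Λ))) (↭.map⁺ res (proj₁ (levelCorners-cols Λ))))
                   (↭.map⁺ (res ∘ col) (levelCorners-↭ Λ))

  -- Distinctness is inherited: back and outer corners together have the same row residues and the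
  -- same column residues as the balls, in another order.
  outers-transversal : Transversal w′ F
  outers-transversal = record
    { sound       = λ c∈ → let i , c∈′ = ∈-tabulate-concatMap⁻ (outerCorners ∘ toList) c∈ in
                            Equivalence.from (forward _) (rep i , c∈′)
    ; complete    = complete′
    ; rows-unique = unique-++ʳ (map (res ∘ row) S′) (subst Unique (List.map-++ (res ∘ row) S′ F) (Unique-resp-↭ rows-↭ B.rows-unique))
    ; cols-unique = unique-++ʳ (map (res ∘ col) S′) (subst Unique (List.map-++ (res ∘ col) S′ F) (Unique-resp-↭ cols-↭ B.cols-unique))
    }
    where
    complete′ : ∀ {c} → Ball w′ c → ∃ λ b → b ∈ F × key b ≡ key c
    complete′ {c} ball = b , ∈-tabulate-concatMap⁺ (outerCorners ∘ toList) (M.res t) b∈ ,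
      trans (sym (key-translate k b)) (cong key (sym c≡))
      where
      t : ℤ
      t = proj₁ (Equivalence.to (forward c) ball)
      k : ℤ
      k = M.ceil t - 1ℤ
      c∈ : c ∈ map (T k) (outer (rep (M.res t)))
      c∈ = subst (c ∈_) (trans (cong outer (M.remainder t)) (outer-translate k (rep (M.res t)))) (proj₂ (Equivalence.to (forward c) ball))
      b : Cell
      b = proj₁ (∈-map⁻ (T k) c∈)
      b∈ : b ∈ outer (rep (M.res t))
      b∈ = proj₁ (proj₂ (∈-map⁻ (T k) c∈))
      c≡ : c ≡ T k b
      c≡ = proj₂ (proj₂ (∈-map⁻ (T k) c∈))

  back-period : ∀ t → back t ≡ T (M.ceil t - 1ℤ) (back (rep (M.res t)))
  back-period t = trans (cong back (M.remainder t)) (back-translate (M.ceil t - 1ℤ) (rep (M.res t)))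

  backs : S′ ≡ tabulate (λ i → back (rep i))
  backs = List.map-tabulate (λ i → level (rep i)) backCorner

  back-∈ : ∀ i → back (rep i) ∈ S′
  back-∈ i = ∈-map⁺ backCorner (∈-tabulate⁺ i)

  ∈-backs : ∀ {c} → c ∈ S′ → ∃ λ i → c ≡ back (rep i)
  ∈-backs c∈ = ∈-tabulate⁻ (subst (_ ∈_) backs c∈)

  back-key : ∀ t → key (back t) ≡ key (back (rep (M.res t)))
  back-key t = trans (cong key (back-period t)) (key-translate (M.ceil t - 1ℤ) (back (rep (M.res t))))

  -- Distinct levels have distinct back corners, so a translation between two of them comes from a
  -- shift of levels by a multiple of m, and within 1, ..., m that shift is 0.
  back-key-injective : ∀ {i j : Fin m} → key (back (rep i)) ≡ key (back (rep j)) → i ≡ j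
  back-key-injective {i} {j} eq = proj₁ (period-unique k (back-injective (trans tr (sym (back-translate k (rep i))))))
    where
    k : ℤ
    k = proj₁ (key≡⇒translate {back (rep i)} {back (rep j)} eq)
    tr : back (rep j) ≡ T k (back (rep i))
    tr = proj₂ (key≡⇒translate {back (rep i)} {back (rep j)} eq)

  -- The entries l and r of the step refer to the given `reps`, the level argument to `S′`. Matching
  -- the two by keys transfers the number of classes and the winding.
  backs-↭ : map key S′ ↭ tabulate (key ∘ reps)
  backs-↭ = subst (_↭ tabulate (key ∘ reps)) (sym (trans (cong (map key) backs) (List.map-tabulate (λ i → back (rep i)) key)))
    (unique-↭ (Unique.tabulate⁺ back-key-injective)
      (Unique.tabulate⁺ λ {x} {y} eq → IsTransversal.distinct transversal x y (key≡⇒translate eq))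
      (All.lookup (All.tabulate⁺ to)) (All.lookup (All.tabulate⁺ from)))
    where
    to : ∀ i → key (back (rep i)) ∈ tabulate (key ∘ reps)
    to i = subst (_∈ tabulate (key ∘ reps)) (trans (sym (key-translate k (reps y))) (cong key (sym tr))) (∈-tabulate⁺ y)
      where
      class : ∃ λ x → Translates n (reps x) (back (rep i))
      class = IsTransversal.complete transversal (rep i , refl)
      y : Fin l
      y = proj₁ class
      k : ℤ
      k = proj₁ (proj₂ class)
      tr : back (rep i) ≡ T k (reps y)
      tr = proj₂ (proj₂ class)
    from : ∀ y → key (reps y) ∈ tabulate (λ i → key (back (rep i)))
    from y = subst (_∈ tabulate (λ i → key (back (rep i)))) (sym (trans (cong key (proj₂ t)) (back-key (proj₁ t)))) (∈-tabulate⁺ (M.res (proj₁ t)))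
      where
      t : S (reps y)
      t = IsTransversal.member transversal y

  backs-length : length S′ ≡ l
  backs-length = trans (sym (List.length-map key S′)) (trans (↭.↭-length backs-↭) (List.length-tabulate (key ∘ reps)))

  backs-winding : winding S′ ≡ par r
  backs-winding = begin
    winding S′                                                  ≡⟨ winding-key S′ ⟩
    sumOf (par ∘ proj₂ ∘ proj₂) (map key S′)                    ≡⟨ sumOf-↭ _ backs-↭ ⟩
    sumOf (par ∘ proj₂ ∘ proj₂) (tabulate (key ∘ reps))         ≡⟨ par-∑ℤ _ (key ∘ reps) _ (λ x → cong par (cong₂ _-_ (sym (ceil≡ (col (reps x)))) (sym (ceil≡ (row (reps x)))))) ⟩
    par (∑ℤ λ x → ⌈ col (reps x) / n ⌉ - ⌈ row (reps x) / n ⌉)  ≡⟨ cong par r-sum ⟨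
    par r                                                       ∎

  -- For i < j ≤ m, back j lies strictly between back i and its translate by n.
  backs-crossings : crossings S′ ≡ (1ℙ ⊕ parity l) ⊗ par r
  backs-crossings = begin
    crossings S′
      ≡⟨ cong₂ _⊕_ (pairSum-map lt (res ∘ row) S′) (pairSum-map lt (res ∘ col) S′) ⟩
    pairSum (λ a b → lt (res (row a)) (res (row b))) S′ ⊕ pairSum (λ a b → lt (res (col a)) (res (col b))) S′
      ≡⟨ pairSum-⊕ _ _ S′ ⟨
    pairSum (λ a b → lt (res (row a)) (res (row b)) ⊕ lt (res (col a)) (res (col b))) S′
      ≡⟨ pairSum-cong pair increasing′ ⟩
    pairSum (λ a b → g a ⊕ g b) S′
      ≡⟨ pairSum-additive g S′ ⟩
    (1ℙ ⊕ parity (length S′)) ⊗ sumOf g S′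
      ≡⟨ cong₂ (λ k s → (1ℙ ⊕ parity k) ⊗ s) backs-length (trans (sumOf-⊕ _ _ S′) backs-winding) ⟩
    (1ℙ ⊕ parity l) ⊗ par r ∎
    where
    g : Cell → Parity
    g c = par (ceil (row c)) ⊕ par (ceil (col c))
    Close : Rel Cell 0ℓ
    Close a b = a StrictlyNorthWestOf b × b StrictlyNorthWestOf T 1ℤ a
    pair : ∀ {a b} → Close a b → lt (res (row a)) (res (row b)) ⊕ lt (res (col a)) (res (col b)) ≡ g a ⊕ g b
    pair {a} {b} ((r , c) , (r′ , c′)) = trans (cong₂ _⊕_ (lt-res r r′) (lt-res c c′))
      (solve 4 (λ a b c d → (a :+ b) :+ (c :+ d) := (a :+ c) :+ (b :+ d)) refl (par (ceil (row a))) (par (ceil (row b))) (par (ceil (col a))) (par (ceil (col b))))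
    increasing′ : AllPairs Close S′
    increasing′ = subst (AllPairs Close) (sym backs) (AllPairs.tabulate⁺-< λ {i} {j} i<j →
      back-mono (M.rep-mono-< i<j) ,
      subst (back (rep j) StrictlyNorthWestOf_) (back-translate 1ℤ (rep i))
        -- Indices run through 1, ..., m, so j is less than i + m, and m levels further is one
        -- translation by (n,n).
        (back-mono (subst (_< rep i + 1ℤ * M) (ℤ.+-identityʳ (rep j)) (M.lex-< j i {0ℤ} {1ℤ} (ℤ.+<+ (ℕ.s≤s ℕ.z≤n))))))

  backs-rows : ∀ k → k ∈ₛ q ⇔ k ∈ map (res ∘ row) S′
  backs-rows k = mk⇔ to from
    where
    to : k ∈ₛ q → k ∈ map (res ∘ row) S′
    to k∈ = subst (_∈ map (res ∘ row) S′)
      (trans (sym (cong proj₁ (back-key (proj₁ (proj₁ (proj₂ c)))))) (trans (cong (res ∘ row) (sym (proj₂ (proj₁ (proj₂ c))))) (∈̄⇒res≡ (proj₂ (proj₂ c)))))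
      (∈-map⁺ (res ∘ row) (back-∈ (M.res (proj₁ (proj₁ (proj₂ c))))))
      where
      c : ∃ λ c → S c × row c ∈̄ k
      c = Equivalence.to (q-rows k) k∈
    from : k ∈ map (res ∘ row) S′ → k ∈ₛ q
    from k∈ = Equivalence.from (q-rows k)
      (proj₁ c , (rep (proj₁ i) , proj₂ i) , subst (row (proj₁ c) ∈̄_) (sym (proj₂ (proj₂ c))) (res-∈̄ (row (proj₁ c))))
      where
      c : ∃ λ c → c ∈ S′ × k ≡ res (row c)
      c = ∈-map⁻ (res ∘ row) k∈
      i : ∃ λ i → proj₁ c ≡ back (rep i)
      i = ∈-backs (proj₁ (proj₂ c))

  backs-cols : ∀ k → k ∈ₛ p ⇔ k ∈ map (res ∘ col) S′
  backs-cols k = mk⇔ to from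
    where
    to : k ∈ₛ p → k ∈ map (res ∘ col) S′
    to k∈ = subst (_∈ map (res ∘ col) S′)
      (trans (sym (cong (proj₁ ∘ proj₂) (back-key (proj₁ (proj₁ (proj₂ c)))))) (trans (cong (res ∘ col) (sym (proj₂ (proj₁ (proj₂ c))))) (∈̄⇒res≡ (proj₂ (proj₂ c)))))
      (∈-map⁺ (res ∘ col) (back-∈ (M.res (proj₁ (proj₁ (proj₂ c))))))
      where
      c : ∃ λ c → S c × col c ∈̄ k
      c = Equivalence.to (p-columns k) k∈
    from : k ∈ map (res ∘ col) S′ → k ∈ₛ p
    from k∈ = Equivalence.from (p-columns k)
      (proj₁ c , (rep (proj₁ i) , proj₂ i) , subst (col (proj₁ c) ∈̄_) (sym (proj₂ (proj₂ c))) (res-∈̄ (col (proj₁ c))))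
      where
      c : ∃ λ c → c ∈ S′ × k ≡ res (col c)
      c = ∈-map⁻ (res ∘ col) k∈
      i : ∃ λ i → proj₁ c ≡ back (rep i)
      i = ∈-backs (proj₁ (proj₂ c))

-- Inversions of a tabloid, row by row

⟦_⟧ : Dec A → Parity
⟦ A? ⟧ = if ⌊ A? ⌋ then 1ℙ else 0ℙ

⟦⟧-parity : (A? : Dec A) → ⟦ A? ⟧ ≡ parity (if ⌊ A? ⌋ then 1 else 0)
⟦⟧-parity (yes _) = refl
⟦⟧-parity (no _)  = refl

-- The condition B is the disjoint union of C and of the conjunction of D and E. Disjointness turns
-- the union into a sum of indicators, with A as a common factor.
⟦⟧-split : ∀ {A B C D E : Set} (A? : Dec A) (B? : Dec B) (C? : Dec C) (D? : Dec D) (E? : Dec E) →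
           (B → C ⊎ (D × E)) → (C → B) → (D × E → B) → (C → E → ⊥) →
           ⟦ A? ×-dec B? ⟧ ≡ ⟦ A? ×-dec C? ⟧ ⊕ ⟦ D? ⟧ ⊗ (⟦ E? ⟧ ⊗ ⟦ A? ⟧)
⟦⟧-split (no _) _ _ D? E? f g h k =
  sym (trans (cong (⟦ D? ⟧ ⊗_) (ℙ.*-zeroʳ ⟦ E? ⟧)) (ℙ.*-zeroʳ ⟦ D? ⟧))
⟦⟧-split (yes _) (yes b) (yes c) (yes d) (yes e) f g h k = contradiction e (k c)
⟦⟧-split (yes _) (yes b) (yes c) (yes d) (no ¬e) f g h k = refl
⟦⟧-split (yes _) (yes b) (yes c) (no ¬d) _       f g h k = refl
⟦⟧-split (yes _) (yes b) (no ¬c) (yes d) (yes e) f g h k = refl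
⟦⟧-split (yes _) (yes b) (no ¬c) (yes d) (no ¬e) f g h k with f b
... | inj₁ c       = contradiction c ¬c
... | inj₂ (_ , e) = contradiction e ¬e
⟦⟧-split (yes _) (yes b) (no ¬c) (no ¬d) _       f g h k with f b
... | inj₁ c       = contradiction c ¬c
... | inj₂ (d , _) = contradiction d ¬d
⟦⟧-split (yes _) (no ¬b) (yes c) _       _       f g h k = contradiction (g c) ¬b
⟦⟧-split (yes _) (no ¬b) (no ¬c) (yes d) (yes e) f g h k = contradiction (h (d , e)) ¬b
⟦⟧-split (yes _) (no ¬b) (no ¬c) (yes d) (no ¬e) f g h k = refl
⟦⟧-split (yes _) (no ¬b) (no ¬c) (no ¬d) _       f g h k = refl

sumOf-filter : ∀ {P : Pred A _} (P? : Decidable P) (f : A → Parity) xs →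
               sumOf f (filter P? xs) ≡ sumOf (λ x → ⟦ P? x ⟧ ⊗ f x) xs
sumOf-filter P? f []       = refl
sumOf-filter P? f (x ∷ xs) with P? x
... | yes _ = cong (f x ⊕_) (sumOf-filter P? f xs)
... | no  _ = sumOf-filter P? f xs

sumOf-members : ∀ {P : Pred (Fin n) _} (P? : Decidable P) (f : Fin n → Parity) {xs} → Unique xs →
                (∀ k → P k ⇔ k ∈ xs) → sumOf (λ x → ⟦ P? x ⟧ ⊗ f x) (allFin n) ≡ sumOf f xs
sumOf-members {n = n} P? f u mem = trans (sym (sumOf-filter P? f (allFin n)))
  (sumOf-↭ f (unique-↭ (Unique.filter⁺ P? (Unique.allFin⁺ n)) u
    (λ k∈ → Equivalence.to (mem _) (proj₂ (∈-filter⁻ P? {xs = allFin n} k∈)))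
    (λ {k} k∈ → ∈-filter⁺ P? (∈-allFin k) (Equivalence.from (mem k) k∈))))

RowsDisjoint : Vec (Subset n) m → Set
RowsDisjoint P = ∀ s t → s ≢ t → Empty (lookup P s ∩ lookup P t)

disjoint-tail : ∀ {p} {P : Vec (Subset n) m} → RowsDisjoint (p ∷ P) → RowsDisjoint P
disjoint-tail dis s t s≢t = dis (Fin.suc s) (Fin.suc t) (s≢t ∘ Fin.suc-injective)

tabloid : (P : Vec (Subset n) m) → RowsDisjoint P → Tabloid n m
tabloid P dis = record { rows = P ; disjoint = dis }

InRows : Vec (Subset n) m → Pred (Fin n) _
InRows P k = ∃ λ s → k ∈ₛ lookup P s

inRows? : (P : Vec (Subset n) m) → Decidable (InRows P)
inRows? P k = Fin.any? λ s → k ∈? lookup P s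

cross : List (Fin n) → List (Fin n) → Parity
cross xs ys = sumOf (λ x → sumOf (lt x) ys) xs

parity-inv : (T : Tabloid n m) →
  parity (inv T) ≡ sumOf (λ i → sumOf (λ j → ⟦ i Fin.<? j ×-dec inLowerRow? T i j ⟧) (allFin n)) (allFin n)
parity-inv {n = n} T = sym $ parity-∑ℕ _ id _ λ i → parity-∑ℕ _ id _ λ j → ⟦⟧-parity (i Fin.<? j ×-dec inLowerRow? T i j)

-- An inversion of the larger tabloid either avoids the new top row or has its larger entry j there
-- and its smaller entry i below. Disjointness of the rows keeps the two cases apart. With the top
-- row listed first, the second kind are the descents counted by `cross xs ys`.
inv-∷ : ∀ {p} {P : Vec (Subset n) m} (dis : RowsDisjoint (p ∷ P)) {xs ys} → Unique xs → Unique ys →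
        (∀ k → k ∈ₛ p ⇔ k ∈ xs) → (∀ k → InRows P k ⇔ k ∈ ys) →
        parity (inv (tabloid (p ∷ P) dis)) ≡ parity (inv (tabloid P (disjoint-tail dis))) ⊕ cross xs ys
inv-∷ {n = n} {p = p} {P = P} dis {xs} {ys} u v memₓ memᵧ = begin
  parity (inv T)
    ≡⟨ parity-inv T ⟩
  sumOf (λ i → sumOf (λ j → ⟦ i Fin.<? j ×-dec inLowerRow? T i j ⟧) (allFin n)) (allFin n)
    ≡⟨ sumOf-cong (allFin n) (λ i → trans (sumOf-cong (allFin n) (pointwise i)) (sumOf-⊕ _ _ (allFin n))) ⟩
  sumOf (λ i → sumOf (λ j → ⟦ i Fin.<? j ×-dec inLowerRow? T′ i j ⟧) (allFin n)
             ⊕ sumOf (λ j → ⟦ inRows? P i ⟧ ⊗ (⟦ j ∈? p ⟧ ⊗ lt j i)) (allFin n)) (allFin n)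
    ≡⟨ sumOf-⊕ _ _ (allFin n) ⟩
  sumOf (λ i → sumOf (λ j → ⟦ i Fin.<? j ×-dec inLowerRow? T′ i j ⟧) (allFin n)) (allFin n)
    ⊕ sumOf (λ i → sumOf (λ j → ⟦ inRows? P i ⟧ ⊗ (⟦ j ∈? p ⟧ ⊗ lt j i)) (allFin n)) (allFin n)
    ≡⟨ cong₂ _⊕_ (sym (parity-inv T′)) (sumOf-cong (allFin n) λ i → trans (sumOf-⊗ ⟦ inRows? P i ⟧ _ (allFin n))
         (cong (⟦ inRows? P i ⟧ ⊗_) (sumOf-members (_∈? p) (λ j → lt j i) u memₓ))) ⟩
  parity (inv T′) ⊕ sumOf (λ i → ⟦ inRows? P i ⟧ ⊗ sumOf (λ j → lt j i) xs) (allFin n)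
    ≡⟨ cong (parity (inv T′) ⊕_) (sumOf-members (inRows? P) _ v memᵧ) ⟩
  parity (inv T′) ⊕ sumOf (λ i → sumOf (λ j → lt j i) xs) ys
    ≡⟨ cong (parity (inv T′) ⊕_) (sumOf-swap (λ i j → lt j i) ys xs) ⟩
  parity (inv T′) ⊕ cross xs ys ∎
  where
  T = tabloid (p ∷ P) dis
  T′ = tabloid P (disjoint-tail dis)
  pointwise : ∀ i j → ⟦ i Fin.<? j ×-dec inLowerRow? T i j ⟧
                    ≡ ⟦ i Fin.<? j ×-dec inLowerRow? T′ i j ⟧ ⊕ ⟦ inRows? P i ⟧ ⊗ (⟦ j ∈? p ⟧ ⊗ lt j i)
  pointwise i j = ⟦⟧-split (i Fin.<? j) (inLowerRow? T i j) (inLowerRow? T′ i j) (inRows? P i) (j ∈? p) split lift first exclusive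
    where
    split : InLowerRow T i j → InLowerRow T′ i j ⊎ (InRows P i × j ∈ₛ p)
    split (Fin.suc s , Fin.zero  , _         , i∈ , j∈) = inj₂ ((s , i∈) , j∈)
    split (Fin.suc s , Fin.suc t , ℕ.s≤s t<s , i∈ , j∈) = inj₁ (s , t , t<s , i∈ , j∈)
    lift : InLowerRow T′ i j → InLowerRow T i j
    lift (s , t , t<s , i∈ , j∈) = Fin.suc s , Fin.suc t , ℕ.s≤s t<s , i∈ , j∈
    first : InRows P i × j ∈ₛ p → InLowerRow T i j
    first ((s , i∈) , j∈) = Fin.suc s , Fin.zero , ℕ.s≤s ℕ.z≤n , i∈ , j∈
    exclusive : InLowerRow T′ i j → j ∈ₛ p → ⊥
    exclusive (_ , t , _ , _ , j∈) j∈p = dis Fin.zero (Fin.suc t) (λ ()) (j , x∈p∩q⁺ (j∈p , j∈))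

-- Removing the first part exchanges even and odd positions, so the two shape statistics together
-- count every part of L once.
parity-invShape : ∀ l (L : Vec ℕ m) → parity (invShape (l ∷ L)) ≡ parity (Vec.sum L) ⊕ parity (invShape L)
parity-invShape l []       = refl
parity-invShape l (k ∷ L) = begin
  parity (k ℕ.+ invShape L)                                          ≡⟨ ℙ.+-homo-+ k (invShape L) ⟩
  parity k ⊕ parity (invShape L)
    ≡⟨ solve 3 (λ k i s → k :+ i := (k :+ s) :+ (s :+ i)) refl (parity k) (parity (invShape L)) (parity (Vec.sum L)) ⟩
  (parity k ⊕ parity (Vec.sum L)) ⊕ (parity (Vec.sum L) ⊕ parity (invShape L))
    ≡⟨ cong₂ _⊕_ (sym (ℙ.+-homo-+ k (Vec.sum L))) (sym (parity-invShape k L)) ⟩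
  parity (k ℕ.+ Vec.sum L) ⊕ parity (invShape (k ∷ L))               ∎

par-odd : ∀ l r → par (if ⌊ l ℕ.% 2 ℕ.≟ 1 ⌋ then r else 0ℤ) ≡ parity l ⊗ par r
par-odd zero          r = refl
par-odd (suc zero)    r = refl
par-odd (suc (suc l)) r = par-odd l r

par-invWeight : ∀ l (L : Vec ℕ m) r R → par (invWeight (l ∷ L) (r ∷ R)) ≡ parity l ⊗ par r ⊕ par (invWeight L R)
par-invWeight l L r R = trans (par-+ (if ⌊ l ℕ.% 2 ℕ.≟ 1 ⌋ then r else 0ℤ) (invWeight L R)) (cong (_⊕ par (invWeight L R)) (par-odd l r))

-- Recursion along the construction

module _ (n : ℕ) .{{_ : NonZero n}} where
  open Statistics n

  crossings-++ : ∀ xs ys → crossings (xs ++ ys) ≡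
    crossings xs ⊕ crossings ys ⊕ (cross (map (res ∘ row) xs) (map (res ∘ row) ys) ⊕ cross (map (res ∘ col) xs) (map (res ∘ col) ys))
  crossings-++ xs ys = begin
    inversions (map (res ∘ row) (xs ++ ys)) ⊕ inversions (map (res ∘ col) (xs ++ ys))
      ≡⟨ cong₂ _⊕_ (one (res ∘ row)) (one (res ∘ col)) ⟩
    (iʳ xs ⊕ iʳ ys ⊕ cross (map (res ∘ row) xs) (map (res ∘ row) ys)) ⊕ (iᶜ xs ⊕ iᶜ ys ⊕ cross (map (res ∘ col) xs) (map (res ∘ col) ys))
      ≡⟨ solve 6 (λ a b c d e f → (a :+ b :+ c) :+ (d :+ e :+ f) := (a :+ d) :+ (b :+ e) :+ (c :+ f)) refl
           (iʳ xs) (iʳ ys) (cross (map (res ∘ row) xs) (map (res ∘ row) ys)) (iᶜ xs) (iᶜ ys) (cross (map (res ∘ col) xs) (map (res ∘ col) ys)) ⟩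
    crossings xs ⊕ crossings ys ⊕ (cross (map (res ∘ row) xs) (map (res ∘ row) ys) ⊕ cross (map (res ∘ col) xs) (map (res ∘ col) ys)) ∎
    where
    iʳ iᶜ : List Cell → Parity
    iʳ zs = inversions (map (res ∘ row) zs)
    iᶜ zs = inversions (map (res ∘ col) zs)
    one : ∀ f → inversions (map f (xs ++ ys)) ≡ inversions (map f xs) ⊕ inversions (map f ys) ⊕ cross (map f xs) (map f ys)
    one f = trans (cong inversions (List.map-++ f xs ys)) (pairSum-++ lt (map f xs) (map f ys))

  winding-++ : ∀ xs ys → winding (xs ++ ys) ≡ winding xs ⊕ winding ys
  winding-++ xs ys = trans (cong₂ _⊕_ (sumOf-++ (par ∘ ceil ∘ row) xs ys) (sumOf-++ (par ∘ ceil ∘ col) xs ys))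
    (solve 4 (λ a b c d → (a :+ b) :+ (c :+ d) := (a :+ c) :+ (b :+ d)) refl
      (sumOf (par ∘ ceil ∘ row) xs) (sumOf (par ∘ ceil ∘ row) ys) (sumOf (par ∘ ceil ∘ col) xs) (sumOf (par ∘ ceil ∘ col) ys))

  -- The invariant of the recursion. The list of balls is left arbitrary, since each step brings its
  -- own list of outer corners and compares the two as transversals. The membership conditions let
  -- `inv-∷` read the lower rows off the balls.
  record Summary (w : PartialPerm n) {m} (P Q : Vec (Subset n) m) (dP : RowsDisjoint P) (dQ : RowsDisjoint Q)
                 (L : Vec ℕ m) (R : Vec ℤ m) : Set where
    field
      balls       : List Cell
      transversal : Transversal w balls
      size        : parity (length balls) ≡ parity (Vec.sum L)
      rows-∈      : ∀ k → InRows Q k ⇔ k ∈ map (res ∘ row) balls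
      cols-∈      : ∀ k → InRows P k ⇔ k ∈ map (res ∘ col) balls
      sign        : crossings balls ⊕ winding balls ≡
                    parity (inv (tabloid P dP)) ⊕ parity (inv (tabloid Q dQ)) ⊕ parity (invShape L) ⊕ par (invWeight L R)

  module _ {w w′ : PartialPerm n} {p q : Subset n} {l : ℕ} {r : ℤ} (σ : Step w p q l r w′)
           (k : ℕ) .{{_ : NonZero k}} (shift : ∀ {a} → Step.C σ a → Step.d̃ σ (translate n 1ℤ a) ≡ + k ℤ.+ Step.d̃ σ a)
           {m} {P Q : Vec (Subset n) m} {L : Vec ℕ m} {R : Vec ℤ m}
           (dP : RowsDisjoint (p ∷ P)) (dQ : RowsDisjoint (q ∷ Q))
           (ih : Summary w′ P Q (disjoint-tail dP) (disjoint-tail dQ) L R) where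
    private
      open Levels σ k shift
      module ih = Summary ih
      B S F : List Cell
      B = levelBalls Λ
      S = levelBacks Λ
      F = levelOuters Λ

      module τ = Transversal balls-transversal
      module τ′ = Transversal outers-transversal

      ∈-extend : ∀ (f : Cell → Fin n) {x : Subset n} {X : Vec (Subset n) m} → map f B ↭ map f (S ++ F) → map f F ↭ map f ih.balls →
                 (∀ i → i ∈ₛ x ⇔ i ∈ map f S) → (∀ i → InRows X i ⇔ i ∈ map f ih.balls) →
                 ∀ i → InRows (x ∷ X) i ⇔ i ∈ map f B
      ∈-extend f {x} {X} B↭ F↭ memₓ memₓₛ i = mk⇔ to from
        where
        ++≡ = List.map-++ f S F
        to : InRows (x ∷ X) i → i ∈ map f B
        to (Fin.zero  , i∈) = ↭.∈-resp-↭ (↭-sym B↭) (subst (i ∈_) (sym ++≡) (∈-++⁺ˡ (Equivalence.to (memₓ i) i∈)))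
        to (Fin.suc s , i∈) = ↭.∈-resp-↭ (↭-sym B↭) (subst (i ∈_) (sym ++≡)
          (∈-++⁺ʳ (map f S) (↭.∈-resp-↭ (↭-sym F↭) (Equivalence.to (memₓₛ i) (s , i∈)))))
        from′ : i ∈ map f S ⊎ i ∈ map f F → InRows (x ∷ X) i
        from′ (inj₁ i∈) = Fin.zero , Equivalence.from (memₓ i) i∈
        from′ (inj₂ i∈) = let s , i∈′ = Equivalence.from (memₓₛ i) (↭.∈-resp-↭ F↭ i∈) in Fin.suc s , i∈′
        from : i ∈ map f B → InRows (x ∷ X) i
        from i∈ = from′ (∈-++⁻ (map f S) (subst (i ∈_) ++≡ (↭.∈-resp-↭ B↭ i∈)))

      rows-F : map (res ∘ row) F ↭ map (res ∘ row) ih.balls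
      rows-F = transversal-rows outers-transversal ih.transversal

      cols-F : map (res ∘ col) F ↭ map (res ∘ col) ih.balls
      cols-F = transversal-cols outers-transversal ih.transversal

      ++-unique : ∀ (f : Cell → Fin n) → map f B ↭ map f (S ++ F) → Unique (map f B) → Unique (map f S)
      ++-unique f B↭ u = unique-++ʳ (map f F) (Unique-resp-↭ (↭-trans B↭ (↭-trans (↭.↭-reflexive (List.map-++ f S F)) (↭.++-comm (map f S) (map f F)))) u)

      inv-step : ∀ (f : Cell → Fin n) {x} {X : Vec (Subset n) m} (dX : RowsDisjoint (x ∷ X)) →
                 map f B ↭ map f (S ++ F) → Unique (map f B) → Unique (map f F) → map f F ↭ map f ih.balls →
                 (∀ i → i ∈ₛ x ⇔ i ∈ map f S) → (∀ i → InRows X i ⇔ i ∈ map f ih.balls) →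
                 parity (inv (tabloid (x ∷ X) dX)) ≡ parity (inv (tabloid X (disjoint-tail dX))) ⊕ cross (map f S) (map f F)
      inv-step f dX B↭ u v F↭ memₓ memₓₛ = inv-∷ dX (++-unique f B↭ u) v memₓ λ i →
        mk⇔ (λ i∈ → ↭.∈-resp-↭ (↭-sym F↭) (Equivalence.to (memₓₛ i) i∈)) (λ i∈ → Equivalence.from (memₓₛ i) (↭.∈-resp-↭ F↭ i∈))

      size-F : parity (length F) ≡ parity (Vec.sum L)
      size-F = trans (cong parity (transversal-length outers-transversal ih.transversal)) ih.size

      length-B : length B ≡ l ℕ.+ length F
      length-B = begin
        length B                             ≡⟨ List.length-map (res ∘ row) B ⟨
        length (map (res ∘ row) B)           ≡⟨ ↭.↭-length rows-↭ ⟩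
        length (map (res ∘ row) (S ++ F))    ≡⟨ List.length-map (res ∘ row) (S ++ F) ⟩
        length (S ++ F)                      ≡⟨ List.length-++ S ⟩
        length S ℕ.+ length F                ≡⟨ cong (ℕ._+ length F) backs-length ⟩
        l ℕ.+ length F                       ∎

      crossRows crossCols : Parity
      crossRows = cross (map (res ∘ row) S) (map (res ∘ row) F)
      crossCols = cross (map (res ∘ col) S) (map (res ∘ col) F)

      crossings-B : crossings B ≡ parity (length F) ⊕ ((1ℙ ⊕ parity l) ⊗ par r ⊕ crossings F ⊕ (crossRows ⊕ crossCols))
      crossings-B = begin
        crossings B                                          ≡⟨ crossings-levelBalls Λ τ.cols-unique ⟩
        parity (length F) ⊕ crossings (levelCorners Λ)       ≡⟨ cong (parity (length F) ⊕_) (crossings-↭ {levelCorners Λ} {S ++ F} (↭.map⁺ key (levelCorners-↭ Λ))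
                                                                  (Unique-resp-↭ (↭-trans rows-↭ (↭.map⁺ (res ∘ row) (↭-sym (levelCorners-↭ Λ)))) τ.rows-unique)
                                                                  (Unique-resp-↭ (↭-trans cols-↭ (↭.map⁺ (res ∘ col) (↭-sym (levelCorners-↭ Λ)))) τ.cols-unique)) ⟩
        parity (length F) ⊕ crossings (S ++ F)               ≡⟨ cong (parity (length F) ⊕_) (crossings-++ S F) ⟩
        parity (length F) ⊕ (crossings S ⊕ crossings F ⊕ (crossRows ⊕ crossCols))
          ≡⟨ cong (λ z → parity (length F) ⊕ (z ⊕ crossings F ⊕ (crossRows ⊕ crossCols))) backs-crossings ⟩
        parity (length F) ⊕ ((1ℙ ⊕ parity l) ⊗ par r ⊕ crossings F ⊕ (crossRows ⊕ crossCols)) ∎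

      winding-B : winding B ≡ par r ⊕ winding F
      winding-B = begin
        winding B                     ≡⟨ winding-levelBalls Λ ⟩
        winding (levelCorners Λ)      ≡⟨ winding-↭ {levelCorners Λ} {S ++ F} (↭.map⁺ key (levelCorners-↭ Λ)) ⟩
        winding (S ++ F)              ≡⟨ winding-++ S F ⟩
        winding S ⊕ winding F         ≡⟨ cong (_⊕ winding F) backs-winding ⟩
        par r ⊕ winding F             ∎

      iP iQ iL iR : Parity
      iP = parity (inv (tabloid P (disjoint-tail dP)))
      iQ = parity (inv (tabloid Q (disjoint-tail dQ)))
      iL = parity (invShape L)
      iR = par (invWeight L R)

      sign-F : crossings F ⊕ winding F ≡ iP ⊕ iQ ⊕ iL ⊕ iR
      sign-F = trans (cong₂ _⊕_ (transversal-crossings outers-transversal ih.transversal) (transversal-winding outers-transversal ih.transversal)) ih.sign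

      sign-B : crossings B ⊕ winding B ≡ parity (inv (tabloid (p ∷ P) dP)) ⊕ parity (inv (tabloid (q ∷ Q) dQ))
                                          ⊕ parity (invShape (l ∷ L)) ⊕ par (invWeight (l ∷ L) (r ∷ R))
      sign-B = begin
        crossings B ⊕ winding B
          ≡⟨ cong₂ _⊕_ crossings-B winding-B ⟩
        (parity (length F) ⊕ ((1ℙ ⊕ parity l) ⊗ par r ⊕ crossings F ⊕ (crossRows ⊕ crossCols))) ⊕ (par r ⊕ winding F)
          -- The back corners give l - 1 times r by their crossings and r once more by their
          -- winding; the total l r is the new term of the weight.
          ≡⟨ solve 7 (λ f l r c x y w → (f :+ ((con 1ℙ :+ l) :* r :+ c :+ (x :+ y))) :+ (r :+ w) := (c :+ w) :+ (y :+ x :+ f :+ l :* r)) refl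
               (parity (length F)) (parity l) (par r) (crossings F) crossRows crossCols (winding F) ⟩
        (crossings F ⊕ winding F) ⊕ (crossCols ⊕ crossRows ⊕ parity (length F) ⊕ parity l ⊗ par r)
          ≡⟨ cong₂ (λ s f → s ⊕ (crossCols ⊕ crossRows ⊕ f ⊕ parity l ⊗ par r)) sign-F size-F ⟩
        (iP ⊕ iQ ⊕ iL ⊕ iR) ⊕ (crossCols ⊕ crossRows ⊕ parity (Vec.sum L) ⊕ parity l ⊗ par r)
          ≡⟨ solve 8 (λ p q l r c d f x → (p :+ q :+ l :+ r) :+ (c :+ d :+ f :+ x) := (p :+ c) :+ (q :+ d) :+ (f :+ l) :+ (x :+ r)) refl
               iP iQ iL iR crossCols crossRows (parity (Vec.sum L)) (parity l ⊗ par r) ⟩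
        (iP ⊕ crossCols) ⊕ (iQ ⊕ crossRows) ⊕ (parity (Vec.sum L) ⊕ iL) ⊕ (parity l ⊗ par r ⊕ iR)
          ≡⟨ cong₂ _⊕_ (cong₂ _⊕_ (cong₂ _⊕_
               (inv-step (res ∘ col) dP cols-↭ τ.cols-unique τ′.cols-unique cols-F backs-cols ih.cols-∈)
               (inv-step (res ∘ row) dQ rows-↭ τ.rows-unique τ′.rows-unique rows-F backs-rows ih.rows-∈))
               (parity-invShape l L)) (par-invWeight l L r R) ⟨
        parity (inv (tabloid (p ∷ P) dP)) ⊕ parity (inv (tabloid (q ∷ Q) dQ))
          ⊕ parity (invShape (l ∷ L)) ⊕ par (invWeight (l ∷ L) (r ∷ R)) ∎

    summary-∷ : Summary w (p ∷ P) (q ∷ Q) dP dQ (l ∷ L) (r ∷ R)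
    summary-∷ = record
      { balls       = B
      ; transversal = balls-transversal
      ; size        = trans (cong parity length-B) (trans (ℙ.+-homo-+ l (length F)) (trans (cong (parity l ⊕_) size-F) (sym (ℙ.+-homo-+ l (Vec.sum L)))))
      ; rows-∈      = ∈-extend (res ∘ row) rows-↭ rows-F backs-rows ih.rows-∈
      ; cols-∈      = ∈-extend (res ∘ col) cols-↭ cols-F backs-cols ih.cols-∈
      ; sign        = sign-B
      }

  summary : ∀ {w m} {P Q : Vec (Subset n) m} {L R} (dP : RowsDisjoint P) (dQ : RowsDisjoint Q) → AMBC w P Q L R →
            Summary w P Q dP dQ L R
  summary dP dQ (done empty) = record
    { balls       = []
    ; transversal = record
      { sound = λ () ; complete = λ b → contradiction b (empty _) ; rows-unique = [] ; cols-unique = [] }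
    ; size        = refl
    ; rows-∈      = λ k → mk⇔ (λ ()) (λ ())
    ; cols-∈      = λ k → mk⇔ (λ ()) (λ ())
    ; sign        = sym (cong (λ z → z ⊕ 0ℙ ⊕ 0ℙ) (cong₂ _⊕_ (no-inversions (tabloid [] dP)) (no-inversions (tabloid [] dQ))))
    }
    where
    no-inversions : (T : Tabloid n 0) → parity (inv T) ≡ 0ℙ
    no-inversions T = trans (parity-inv T) (trans (sumOf-cong (allFin n) λ i →
      trans (sumOf-cong (allFin n) λ j → none i j) (sumOf-0 (allFin n))) (sumOf-0 (allFin n)))
      where
      none : ∀ i j → ⟦ i Fin.<? j ×-dec inLowerRow? T i j ⟧ ≡ 0ℙ
      none i j with i Fin.<? j
      ... | yes _ = refl
      ... | no  _ = refl
  summary dP dQ (next _ σ rest) =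
    summary-∷ σ (suc (proj₁ period)) (proj₂ period) dP dQ (summary (disjoint-tail dP) (disjoint-tail dQ) rest)
    where
    period : ∃ λ m → ∀ {a} → Step.C σ a → Step.d̃ σ (translate n 1ℤ a) ≡ + suc m ℤ.+ Step.d̃ σ a
    period = Numbering.period-∃ (IsChannel.isStream (IsSouthWestChannel.isChannel (Step.C-southWest σ))) (Step.d̃-numbering σ) (Step.d-max σ)

allFin-increasing : ∀ n → AllPairs Fin._<_ (allFin n)
allFin-increasing n = AllPairs.tabulate⁺-< id

pairSum-0 : ∀ (xs : List A) → pairSum (λ _ _ → 0ℙ) xs ≡ 0ℙ
pairSum-0 []       = refl
pairSum-0 (x ∷ xs) = trans (cong (_⊕ pairSum (λ _ _ → 0ℙ) xs) (sumOf-0 xs)) (pairSum-0 xs)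

concatMap-unique : ∀ {f : A → List A′} (tag : A′ → A) {xs} → Unique xs → (∀ x → Unique (f x)) →
                   (∀ {x y} → y ∈ f x → tag y ≡ x) → Unique (concatMap f xs)
concatMap-unique {f = f} tag u each tagged = Unique.concat⁺
  (All.map⁺ (All.tabulate λ {x} _ → each x))
  (AllPairs.map⁺ (AllPairs.map disjoint u))
  where
  disjoint : ∀ {x y} → x ≢ y → Disjoint (f x) (f y)
  disjoint x≢y (z∈ , z∈′) = x≢y (trans (sym (tagged z∈)) (tagged z∈′))

parity-concatMap : ∀ (f : A → List A′) xs → parity (length (concatMap f xs)) ≡ sumOf (parity ∘ length ∘ f) xs
parity-concatMap f []       = refl
parity-concatMap f (x ∷ xs) = trans (cong parity (List.length-++ (f x)))
  (trans (ℙ.+-homo-+ (length (f x)) _) (cong (parity (length (f x)) ⊕_) (parity-concatMap f xs)))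

-- Integer intervals

pos : ℤ → ℕ
pos (+ k)    = k
pos -[1+ _ ] = 0

pos-< : ∀ {i} z → i ℕ.< pos z → + i < z
pos-< (+ k) i<k = ℤ.+<+ i<k

<-pos : ∀ {i} z → + i < z → i ℕ.< pos z
<-pos (+ k) (ℤ.+<+ i<k) = i<k

-- At most one of z and `- z` is positive. Two truncated counts of opposite gaps thus combine into
-- `par z`, which is additive although `pos` is not.
pos-neg : ∀ z → parity (pos z) ⊕ parity (pos (- z)) ≡ par z
pos-neg (+ zero)  = refl
pos-neg (+ suc k) = ℙ.+-identityʳ (parity (suc k))
pos-neg -[1+ k ]  = refl

interval : ℤ → ℤ → List ℤ
interval lo hi = map (λ i → lo + + i) (upTo (pos (hi - lo)))

interval-unique : ∀ lo hi → Unique (interval lo hi)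
interval-unique lo hi = Unique.map⁺ (λ {i} {j} eq → ℤ.+-injective (trans (cancel lo (+ i)) (trans (cong (_- lo) eq) (sym (cancel lo (+ j))))))
                                    (Unique.upTo⁺ (pos (hi - lo)))
  where
  cancel : ∀ a b → b ≡ (a + b) - a
  cancel = solve-∀

∈-interval⁻ : ∀ {lo hi k} → k ∈ interval lo hi → lo ≤ k × k < hi
∈-interval⁻ {lo} {hi} {k} k∈ =
  subst (lo ≤_) (sym (proj₂ (proj₂ i))) (ℤ.i≤i+j lo (+ proj₁ i)) ,
  subst₂ _<_ (sym (proj₂ (proj₂ i))) (restore lo hi) (ℤ.+-monoʳ-< lo (pos-< (hi - lo) (∈-upTo⁻ (proj₁ (proj₂ i)))))
  where
  i : ∃ λ i → i ∈ upTo (pos (hi - lo)) × k ≡ lo + + i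
  i = ∈-map⁻ (λ i → lo + + i) k∈
  restore : ∀ a b → a + (b - a) ≡ b
  restore = solve-∀

∈-interval⁺ : ∀ {lo hi k} → lo ≤ k → k < hi → k ∈ interval lo hi
∈-interval⁺ {lo} {hi} {k} lo≤k k<hi = subst (_∈ interval lo hi) (trans (cong (λ z → lo + z) i≡) (restore lo k))
  (∈-map⁺ (λ i → lo + + i) (∈-upTo⁺ (<-pos (hi - lo) (subst (_< hi - lo) (sym i≡) (ℤ.+-monoˡ-< (- lo) k<hi)))))
  where
  i≡ : + ∣ k - lo ∣ ≡ k - lo
  i≡ = ℤ.0≤i⇒+∣i∣≡i (ℤ.i≤j⇒0≤j-i lo≤k)
  restore : ∀ a b → a + (b - a) ≡ b
  restore = solve-∀

interval-length : ∀ lo hi → length (interval lo hi) ≡ pos (hi - lo)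
interval-length lo hi = trans (List.length-map (λ i → lo + + i) (upTo (pos (hi - lo)))) (List.length-upTo (pos (hi - lo)))

-- The length and the displacement of an affine permutation

module Length (n : ℕ) .{{_ : NonZero n}} where
  open Statistics n

  -- The least k with u < v + k n.
  threshold : ℤ → ℤ → ℤ
  threshold u v = ceil u - ceil v + + (if ⌊ res u Fin.<? res v ⌋ then 0 else 1)

  private
    move⁺ : ∀ a b c k → a + c ≤ b + k → a - b + c ≤ k
    move⁺ a b c k le = subst₂ _≤_ (left a b c) (right b k) (ℤ.+-monoˡ-≤ (- b) le)
      where
      left : ∀ a b c → (a + c) + - b ≡ a - b + c
      left = solve-∀
      right : ∀ b k → (b + k) + - b ≡ k
      right = solve-∀

    move⁻ : ∀ a b c k → a - b + c ≤ k → a + c ≤ b + k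
    move⁻ a b c k le = subst (_≤ b + k) (left a b c) (ℤ.+-monoʳ-≤ b le)
      where
      left : ∀ a b c → b + (a - b + c) ≡ a + c
      left = solve-∀

  threshold-to : ∀ u v k → u < v + k * N → threshold u v ≤ k
  threshold-to u v k u<v with res u Fin.<? res v
  ... | yes _ = move⁺ (ceil u) (ceil v) 0ℤ k
    (subst₂ _≤_ (sym (ℤ.+-identityʳ (ceil u))) (ceil-translate v k) (<⇒ceil≤ u<v))
  ... | no ≮  = move⁺ (ceil u) (ceil v) 1ℤ k
    (subst₂ _≤_ (ℤ.+-comm 1ℤ (ceil u)) (ceil-translate v k)
      (ℤ.i<j⇒suc[i]≤j (ℤ.≤∧≢⇒< (<⇒ceil≤ u<v) λ eq → ≮ (subst (res u Fin.<_) (res-translate v k) (<⇒res< eq u<v)))))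

  threshold-from : ∀ u v k → threshold u v ≤ k → u < v + k * N
  threshold-from u v k le with res u Fin.<? res v
  ... | no _ = ceil<⇒< (subst (ceil u <_) (sym (ceil-translate v k))
    (ℤ.suc[i]≤j⇒i<j (subst (_≤ ceil v + k) (ℤ.+-comm (ceil u) 1ℤ) (move⁻ (ceil u) (ceil v) 1ℤ k le))))
  ... | yes lt with ceil u ℤ.≟ ceil (v + k * N)
  ...   | yes eq = res<⇒< eq (subst (res u Fin.<_) (sym (res-translate v k)) lt)
  ...   | no ≢   = ceil<⇒< (ℤ.≤∧≢⇒< (subst₂ _≤_ (ℤ.+-identityʳ (ceil u)) (sym (ceil-translate v k)) (move⁻ (ceil u) (ceil v) 0ℤ k le)) ≢)

  -- For incongruent u and v exactly one of u < v + k n and v < u - k n holds, so k reaches the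
  -- threshold of (u , v) exactly when -k stays below that of (v , u).
  threshold-flip : ∀ {u v} → res u ≢ res v → threshold v u ≡ 1ℤ - threshold u v
  threshold-flip {u} {v} ≢ with res u Fin.<? res v | res v Fin.<? res u
  ... | yes p | yes q = contradiction q (ℕ.<-asym p)
  ... | yes p | no  q = flip₀ (ceil u) (ceil v)
    where
    flip₀ : ∀ a b → b - a + 1ℤ ≡ 1ℤ - (a - b + 0ℤ)
    flip₀ = solve-∀
  ... | no p  | yes q = flip₁ (ceil u) (ceil v)
    where
    flip₁ : ∀ a b → b - a + 0ℤ ≡ 1ℤ - (a - b + 1ℤ)
    flip₁ = solve-∀
  ... | no p  | no  q = contradiction (Fin.≤-antisym (ℕ.≮⇒≥ q) (ℕ.≮⇒≥ p)) ≢

  threshold-refl : ∀ u → threshold u u ≡ 1ℤ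
  threshold-refl u with res u Fin.<? res u
  ... | yes p = contradiction p (ℕ.<-irrefl refl)
  ... | no  _ = cong (_+ 1ℤ) (ℤ.+-inverseʳ (ceil u))

  par-threshold : ∀ u v → par (threshold u v) ≡ 1ℙ ⊕ (par (ceil u) ⊕ par (ceil v) ⊕ lt (res v) (res u))
  par-threshold u v = begin
    par (ceil u - ceil v + + (if ⌊ res u Fin.<? res v ⌋ then 0 else 1))
      ≡⟨ par-+ (ceil u - ceil v) _ ⟩
    par (ceil u - ceil v) ⊕ par (+ (if ⌊ res u Fin.<? res v ⌋ then 0 else 1))
      ≡⟨ cong₂ _⊕_ (par-minus (ceil u) (ceil v)) (bracket (res u Fin.<? res v)) ⟩
    (par (ceil u) ⊕ par (ceil v)) ⊕ (1ℙ ⊕ lt (res v) (res u))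
      ≡⟨ solve 3 (λ a b c → (a :+ b) :+ (con 1ℙ :+ c) := con 1ℙ :+ (a :+ b :+ c)) refl (par (ceil u)) (par (ceil v)) (lt (res v) (res u)) ⟩
    1ℙ ⊕ (par (ceil u) ⊕ par (ceil v) ⊕ lt (res v) (res u)) ∎
    where
    bracket : ∀ {P : Set} (P? : Dec P) → par (+ (if ⌊ P? ⌋ then 0 else 1)) ≡ 1ℙ ⊕ (if ⌊ P? ⌋ then 1ℙ else 0ℙ)
    bracket (yes _) = refl
    bracket (no _)  = refl

  module _ (w : AffinePerm n) where
    open AffinePerm w
    open Balls (toPartial w)
    private T = translate n

    ball : Fin n → Cell
    ball x = rep x , to (rep x)

    normal-form : ∀ {c} → Ball (toPartial w) c → c ≡ T (ceil (row c) - 1ℤ) (ball (res (row c)))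
    normal-form {c} b =
      Ball-row b (Ball-translate (ceil (row c) - 1ℤ) {ball (res (row c))} refl) (remainder (row c))

    B : List Cell
    B = map ball (allFin n)

    private
      rows≡ : map (res ∘ row) B ≡ allFin n
      rows≡ = trans (sym (List.map-∘ (allFin n))) (trans (List.map-cong res-rep≡ (allFin n)) (List.map-id (allFin n)))

      cols≡ : map (res ∘ col) B ≡ map (res ∘ to ∘ rep) (allFin n)
      cols≡ = sym (List.map-∘ (allFin n))

    col-injective : ∀ {x y} → res (to (rep x)) ≡ res (to (rep y)) → x ≡ y
    col-injective {x} {y} eq = proj₁ (decompose-unique x y {k} {0ℤ} (trans (sym (cong row moved)) (sym (ℤ.+-identityʳ (rep y)))))
      where
      k : ℤ
      k = ceil (to (rep y)) - ceil (to (rep x))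
      moved : ball y ≡ T k (ball x)
      moved = Ball-col refl (Ball-translate k {ball x} refl) (res≡⇒translate eq)

    affine-transversal : Transversal (toPartial w) B
    affine-transversal = record
      { sound       = All.lookup {P = Ball (toPartial w)} (All.map⁺ {f = ball} (All.tabulate λ {x} _ → refl))
      ; complete    = λ {c} b → ball (res (row c)) , ∈-map⁺ ball (∈-allFin (res (row c))) ,
                        sym (trans (cong key (normal-form b)) (key-translate (ceil (row c) - 1ℤ) (ball (res (row c)))))
      ; rows-unique = subst Unique (sym rows≡) (Unique.allFin⁺ n)
      ; cols-unique = subst Unique (sym cols≡) (Unique.map⁺ col-injective (Unique.allFin⁺ n))
      }

    -- The winding modulo 2 of the ball in row `rep x`, whose row ceiling is 1.
    v : Fin n → Parity
    v x = 1ℙ ⊕ par (ceil (to (rep x)))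

    winding-B : winding B ≡ sumOf v (allFin n)
    winding-B = begin
      winding B ≡⟨ cong₂ _⊕_ (sumOf-map (par ∘ ceil ∘ row) ball (allFin n)) (sumOf-map (par ∘ ceil ∘ col) ball (allFin n)) ⟩
      sumOf (λ x → par (ceil (rep x))) (allFin n) ⊕ sumOf (λ x → par (ceil (to (rep x)))) (allFin n)
        ≡⟨ cong (_⊕ sumOf (λ x → par (ceil (to (rep x)))) (allFin n)) (sumOf-cong (allFin n) λ x → cong par (ceil-rep≡ x)) ⟩
      sumOf (λ x → 1ℙ) (allFin n) ⊕ sumOf (λ x → par (ceil (to (rep x)))) (allFin n)
        ≡⟨ sumOf-⊕ (λ _ → 1ℙ) _ (allFin n) ⟨
      sumOf v (allFin n) ∎

    colInversions : Parity
    colInversions = pairSum (λ x y → lt (res (to (rep x))) (res (to (rep y)))) (allFin n)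

    crossings-B : crossings B ≡ colInversions
    crossings-B = begin
      inversions (map (res ∘ row) B) ⊕ inversions (map (res ∘ col) B)
        ≡⟨ cong₂ (λ xs ys → inversions xs ⊕ inversions ys) rows≡ cols≡ ⟩
      inversions (allFin n) ⊕ inversions (map (res ∘ to ∘ rep) (allFin n))
        ≡⟨ cong₂ _⊕_ (trans (pairSum-cong (λ {x} {y} x<y → lt-no {x = x} {y} (ℕ.<⇒≤ x<y)) (allFin-increasing n)) (pairSum-0 (allFin n)))
                     (pairSum-map lt (res ∘ to ∘ rep) (allFin n)) ⟩
      colInversions ∎

    -- Column minus row is a difference of residue representatives plus n times the winding of the
    -- ball. The columns run through every residue once, so the representatives cancel in the sum.
    displacement-parity : par (displacement w) ≡ parity n ⊗ sumOf v (allFin n)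
    displacement-parity = begin
      par (displacement w)
        ≡⟨ par-∑ℤ {n = n} (λ x → par (to (rep x) - rep x)) id (λ x → to (rep x) - rep x) (λ _ → refl) ⟨
      sumOf (λ x → par (to (rep x) - rep x)) (allFin n)
        ≡⟨ sumOf-cong (allFin n) pointwise ⟩
      sumOf (λ x → (par (rep (res (to (rep x)))) ⊕ par (rep x)) ⊕ parity n ⊗ v x) (allFin n)
        ≡⟨ trans (sumOf-⊕ _ _ (allFin n)) (cong₂ _⊕_ (sumOf-⊕ _ _ (allFin n)) (sumOf-⊗ (parity n) v (allFin n))) ⟩
      (sumOf (λ x → par (rep (res (to (rep x))))) (allFin n) ⊕ sumOf (par ∘ rep) (allFin n)) ⊕ parity n ⊗ sumOf v (allFin n)
        ≡⟨ cong (λ s → (s ⊕ sumOf (par ∘ rep) (allFin n)) ⊕ parity n ⊗ sumOf v (allFin n))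
             (trans (sym (sumOf-map (par ∘ rep) (res ∘ to ∘ rep) (allFin n))) (sumOf-↭ (par ∘ rep) cols-↭′)) ⟩
      (sumOf (par ∘ rep) (allFin n) ⊕ sumOf (par ∘ rep) (allFin n)) ⊕ parity n ⊗ sumOf v (allFin n)
        ≡⟨ cong (_⊕ parity n ⊗ sumOf v (allFin n)) (ℙ.p+p≡0ℙ (sumOf (par ∘ rep) (allFin n))) ⟩
      parity n ⊗ sumOf v (allFin n) ∎
      where
      onto : ∀ k → k ∈ map (res ∘ to ∘ rep) (allFin n)
      onto k = subst₂ _∈_ (trans (cong (proj₁ ∘ proj₂) (proj₂ (proj₂ b))) (res-rep≡ k)) cols≡ (∈-map⁺ (res ∘ col) (proj₁ (proj₂ b)))
        where
        x : ∃ λ x → ∀ {z} → z ≡ x → to z ≡ rep k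
        x = proj₂ bijective (rep k)
        b : ∃ λ b → b ∈ B × key b ≡ key (proj₁ x , rep k)
        b = Transversal.complete affine-transversal {proj₁ x , rep k} (cong just (proj₂ x refl))
      cols-↭′ : map (res ∘ to ∘ rep) (allFin n) ↭ allFin n
      cols-↭′ = unique-↭ (Unique.map⁺ col-injective (Unique.allFin⁺ n)) (Unique.allFin⁺ n) (λ {k} _ → ∈-allFin k) (λ {k} _ → onto k)
      pointwise : ∀ x → par (to (rep x) - rep x) ≡ (par (rep (res (to (rep x)))) ⊕ par (rep x)) ⊕ parity n ⊗ v x
      pointwise x = begin
        par (a - rep x)                                 ≡⟨ par-minus a (rep x) ⟩
        par a ⊕ par (rep x)                             ≡⟨ solve 3 (λ a r n → a :+ r := ((a :+ n) :+ n) :+ r) refl (par a) (par (rep x)) (parity n) ⟩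
        ((par a ⊕ parity n) ⊕ parity n) ⊕ par (rep x)   ≡⟨ cong (λ z → (z ⊕ parity n) ⊕ par (rep x)) (par-+ a N) ⟨
        (par (a + N) ⊕ parity n) ⊕ par (rep x)          ≡⟨ cong (λ z → (par z ⊕ parity n) ⊕ par (rep x)) (decompose a) ⟩
        (par (rep (res a) + ceil a * N) ⊕ parity n) ⊕ par (rep x)
          ≡⟨ cong (λ z → (z ⊕ parity n) ⊕ par (rep x)) (trans (par-+ (rep (res a)) (ceil a * N)) (cong (par (rep (res a)) ⊕_) (par-* (ceil a) N))) ⟩
        ((par (rep (res a)) ⊕ par (ceil a) ⊗ parity n) ⊕ parity n) ⊕ par (rep x)
          ≡⟨ solve 4 (λ s c n r → ((s :+ c :* n) :+ n) :+ r := (s :+ r) :+ n :* (con 1ℙ :+ c)) refl (par (rep (res a))) (par (ceil a)) (parity n) (par (rep x)) ⟩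
        (par (rep (res a)) ⊕ par (rep x)) ⊕ parity n ⊗ v x ∎
        where
        a : ℤ
        a = to (rep x)

    -- (x , y , k) encodes the translation class of the pair of balls in rows x and y + k n.

    Triple : Set
    Triple = Fin n × Fin n × ℤ

    -- The ball in row y + k n lies south of the ball in row x from k = `lo x y` on. It lies to the
    -- west when w(y) < w(x) - k n, that is, when -k reaches a threshold; this is a strict upper
    -- bound on k.
    lo hi : Fin n → Fin n → ℤ
    lo x y = threshold (rep x) (rep y)
    hi x y = 1ℤ - threshold (to (rep y)) (to (rep x))

    triplesFrom : Fin n → Fin n → List Triple
    triplesFrom x y = map (λ k → x , y , k) (interval (lo x y) (hi x y))

    triples : List Triple
    triples = concatMap (λ x → concatMap (triplesFrom x) (allFin n)) (allFin n)

    triplesFrom-tag : ∀ {x y t} → t ∈ triplesFrom x y → proj₁ t ≡ x × proj₁ (proj₂ t) ≡ y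
    triplesFrom-tag {x} {y} t∈ = let k , _ , eq = ∈-map⁻ (λ k → x , y , k) t∈ in cong proj₁ eq , cong (proj₁ ∘ proj₂) eq

    triples-unique : Unique triples
    triples-unique = concatMap-unique proj₁ (Unique.allFin⁺ n)
      (λ x → concatMap-unique (proj₁ ∘ proj₂) (Unique.allFin⁺ n)
        (λ y → Unique.map⁺ (cong (proj₂ ∘ proj₂)) (interval-unique (lo x y) (hi x y)))
        (proj₂ ∘ triplesFrom-tag))
      (λ {x} t∈ → proj₁ (triplesFrom-tag (proj₂ (proj₂ (find (∈-concatMap⁻ (triplesFrom x) {xs = allFin n} t∈))))))

    ∈-triples⁺ : ∀ {x y k} → lo x y ≤ k → k < hi x y → (x , y , k) ∈ triples
    ∈-triples⁺ {x} {y} {k} l h = ∈-concatMap⁺ (λ x → concatMap (triplesFrom x) (allFin n)) {xs = allFin n} (lose (∈-allFin x)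
      (∈-concatMap⁺ (triplesFrom x) {xs = allFin n} (lose (∈-allFin y) (∈-map⁺ (λ k → x , y , k) (∈-interval⁺ l h)))))

    ∈-triples⁻ : ∀ {x y k} → (x , y , k) ∈ triples → lo x y ≤ k × k < hi x y
    ∈-triples⁻ {x} {y} {k} t∈ =
      let x′ , _ , t∈x = find (∈-concatMap⁻ (λ x → concatMap (triplesFrom x) (allFin n)) {xs = allFin n} t∈)
          y′ , _ , t∈y = find (∈-concatMap⁻ (triplesFrom x′) {xs = allFin n} t∈x)
          k′ , k∈ , eq = ∈-map⁻ (λ k → x′ , y′ , k) t∈y
          l , h = ∈-interval⁻ k∈
          x≡ = cong proj₁ eq
          y≡ = cong (proj₁ ∘ proj₂) eq
          k≡ = cong (proj₂ ∘ proj₂) eq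
      in subst₂ _≤_ (sym (cong₂ lo x≡ y≡)) (sym k≡) l , subst₂ _<_ (sym k≡) (sym (cong₂ hi x≡ y≡)) h

    code : Cell × Cell → Triple
    code (a , b) = res (row a) , res (row b) , ceil (row b) - ceil (row a)

    code-translate : ∀ k a b → code (T k a , T k b) ≡ code (a , b)
    code-translate k a b = cong₂ _,_ (res-translate (row a) k) (cong₂ _,_ (res-translate (row b) k)
      (trans (cong₂ _-_ (ceil-translate (row b) k) (ceil-translate (row a) k)) (cancel (ceil (row b)) (ceil (row a)) k)))
      where
      cancel : ∀ a b k → (a + k) - (b + k) ≡ a - b
      cancel = solve-∀

    private
      cancel-translate : ∀ {r r′ i i′} → r + i * N < r′ + i′ * N → r < r′ + (i′ - i) * N
      cancel-translate {r} {r′} {i} {i′} lt = subst₂ _<_ (left r i N) (right r′ i i′ N) (ℤ.+-monoˡ-< (- (i * N)) lt)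
        where
        left : ∀ r i N → (r + i * N) + - (i * N) ≡ r
        left = solve-∀
        right : ∀ r i i′ N → (r + i′ * N) + - (i * N) ≡ r + (i′ - i) * N
        right = solve-∀

      shift-difference : ∀ i i′ → (i′ - 1ℤ) - (i - 1ℤ) ≡ i′ - i
      shift-difference = solve-∀

      hi-to : ∀ {x y k} → to (rep y) + k * N < to (rep x) → k < hi x y
      hi-to {x} {y} {k} lt = subst (_< hi x y) (ℤ.neg-involutive k) (negate (threshold-to (to (rep y)) (to (rep x)) (- k)
        (subst₂ _<_ (left (to (rep y)) k N) (right (to (rep x)) k N) (ℤ.+-monoˡ-< (- (k * N)) lt))))
        where
        left : ∀ a k N → (a + k * N) + - (k * N) ≡ a
        left = solve-∀
        right : ∀ a k N → a + - (k * N) ≡ a + - k * N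
        right = solve-∀
        negate : ∀ {t j} → t ≤ j → - j < 1ℤ - t
        negate le = ℤ.suc[i]≤j⇒i<j (ℤ.+-monoʳ-≤ 1ℤ (ℤ.neg-mono-≤ le))

      hi-from : ∀ {x y k} → k < hi x y → to (rep y) + k * N < to (rep x)
      hi-from {x} {y} {k} lt = subst (to (rep y) + k * N <_) (cancel (to (rep x)) k N)
        (ℤ.+-monoˡ-< (k * N) (threshold-from (to (rep y)) (to (rep x)) (- k) (negate lt)))
        where
        cancel : ∀ a k N → (a + - k * N) + k * N ≡ a
        cancel = solve-∀
        negate : ∀ {t} → k < 1ℤ - t → t ≤ - k
        negate {t} lt = subst (_≤ - k) (ℤ.neg-involutive t)
          (ℤ.neg-mono-≤ (subst (k ≤_) (ℤ.pred-suc (- t)) (ℤ.i<j⇒i≤pred[j] lt)))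

    triple-of-inversion : ∀ {a b} → Inversion (toPartial w) (a , b) → code (a , b) ∈ triples
    triple-of-inversion {a} {b} (ba , bb , (r , c)) = ∈-triples⁺
      (threshold-to (rep x) (rep y) k (subst (λ z → rep x < rep y + z * N) (shift-difference (ceil (row a)) (ceil (row b)))
        (cancel-translate {rep x} {rep y} {i} {j} (subst₂ _<_ (cong row na) (cong row nb) r))))
      (hi-to {x} {y} {k} (flip (subst₂ _<_ (cong col nb) (cong col na) c)))
      where
      x y : Fin n
      x = res (row a)
      y = res (row b)
      k i j : ℤ
      k = ceil (row b) - ceil (row a)
      i = ceil (row a) - 1ℤ
      j = ceil (row b) - 1ℤ
      na : a ≡ T i (ball x)
      na = normal-form ba
      nb : b ≡ T j (ball y)
      nb = normal-form bb
      flip : to (rep y) + j * N < to (rep x) + i * N → to (rep y) + k * N < to (rep x)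
      flip lt = subst₂ _<_ (left (to (rep y)) (ceil (row a)) (ceil (row b)) N) (right (to (rep x)) i N) (ℤ.+-monoˡ-< (- (i * N)) lt)
        where
        left : ∀ a i j N → (a + (j - 1ℤ) * N) + - ((i - 1ℤ) * N) ≡ a + (j - i) * N
        left = solve-∀
        right : ∀ a i N → (a + i * N) + - (i * N) ≡ a
        right = solve-∀

    inversion-of-triple : ∀ {x y k} → (x , y , k) ∈ triples → Inversion (toPartial w) (ball x , T k (ball y))
    inversion-of-triple {x} {y} {k} t∈ = refl , Ball-translate k {ball y} refl ,
      threshold-from (rep x) (rep y) k (proj₁ (∈-triples⁻ t∈)) , hi-from {x} {y} {k} (proj₂ (∈-triples⁻ t∈))

    code-triple : ∀ x y k → code (ball x , T k (ball y)) ≡ (x , y , k)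
    code-triple x y k = cong₂ _,_ (res-rep≡ x) (cong₂ _,_ (trans (res-translate (rep y) k) (res-rep≡ y))
      (trans (cong₂ _-_ (trans (ceil-translate (rep y) k) (cong (_+ k) (ceil-rep≡ y))) (ceil-rep≡ x)) (cancel k)))
      where
      cancel : ∀ k → (1ℤ + k) - 1ℤ ≡ k
      cancel = solve-∀

    code-injective : ∀ {a b a′ b′} → Inversion (toPartial w) (a , b) → Inversion (toPartial w) (a′ , b′) →
                     code (a , b) ≡ code (a′ , b′) → PairTranslates n (a , b) (a′ , b′)
    code-injective {a} {b} {a′} {b′} (ba , bb , _) (ba′ , bb′ , _) eq = k ,
      Ball-row ba′ (Ball-translate k ba) (res≡⇒translate (cong proj₁ eq)) ,
      Ball-row bb′ (Ball-translate k bb) (trans (res≡⇒translate (cong (proj₁ ∘ proj₂) eq)) (cong (λ z → row b + z * N) k≡))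
      where
      k : ℤ
      k = ceil (row a′) - ceil (row a)
      regroup : ∀ b′ b a′ → b′ - b ≡ (b′ - a′) + (a′ - b)
      regroup = solve-∀
      cancel : ∀ b a a′ → (b - a) + (a′ - b) ≡ a′ - a
      cancel = solve-∀
      k≡ : ceil (row b′) - ceil (row b) ≡ k
      k≡ = begin
        ceil (row b′) - ceil (row b)
          ≡⟨ regroup (ceil (row b′)) (ceil (row b)) (ceil (row a′)) ⟩
        (ceil (row b′) - ceil (row a′)) + (ceil (row a′) - ceil (row b))
          ≡⟨ cong (_+ (ceil (row a′) - ceil (row b))) (cong (proj₂ ∘ proj₂) eq) ⟨
        (ceil (row b) - ceil (row a)) + (ceil (row a′) - ceil (row b))
          ≡⟨ cancel (ceil (row b)) (ceil (row a)) (ceil (row a′)) ⟩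
        k ∎

    module _ {ℓ : ℕ} (reps : Fin ℓ → Cell × Cell) (isT : IsTransversal (PairTranslates n) (Inversion (toPartial w)) reps) where
      open IsTransversal isT

      -- `code` is constant on translation classes and separates those of inversions, and its values
      -- on inversions are exactly the listed triples. Hence ℓ can be found by counting triples.
      codes-↭ : tabulate (code ∘ reps) ↭ triples
      codes-↭ = unique-↭ (Unique.tabulate⁺ λ {x} {y} eq → distinct x y (code-injective (member x) (member y) eq)) triples-unique
        (All.lookup (All.tabulate⁺ λ x → triple-of-inversion (member x))) (λ {t} t∈ → from t t∈)
        where
        from : ∀ t → t ∈ triples → t ∈ tabulate (code ∘ reps)
        from (x , y , k) t∈ = subst (_∈ tabulate (code ∘ reps)) (begin
          code (reps z)                                       ≡⟨ code-translate j (proj₁ (reps z)) (proj₂ (reps z)) ⟨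
          code (T j (proj₁ (reps z)) , T j (proj₂ (reps z)))  ≡⟨ cong₂ (λ a b → code (a , b)) (proj₁ (proj₂ (proj₂ class))) (proj₂ (proj₂ (proj₂ class))) ⟨
          code (ball x , T k (ball y))                        ≡⟨ code-triple x y k ⟩
          (x , y , k)                                         ∎) (∈-tabulate⁺ z)
          where
          class : ∃ λ z → PairTranslates n (reps z) (ball x , T k (ball y))
          class = complete (inversion-of-triple t∈)
          z : Fin ℓ
          z = proj₁ class
          j : ℤ
          j = proj₁ (proj₂ class)

      length-triples : ℓ ≡ length triples
      length-triples = trans (sym (List.length-tabulate (code ∘ reps))) (↭.↭-length codes-↭)

    gap : Fin n → Fin n → ℤ
    gap x y = hi x y - lo x y

    -- A ball and its translates form no inversion: both thresholds are 1, so the gap is -1 and is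
    -- truncated to 0.
    gap-diagonal : ∀ x → parity (pos (gap x x)) ≡ 0ℙ
    gap-diagonal x = cong (parity ∘ pos) (cong₂ (λ s t → (1ℤ - s) - t) (threshold-refl (to (rep x))) (threshold-refl (rep x)))

    -- Both thresholds flip, so the gap changes sign, and at most one of the two orders contributes
    -- inversions.
    gap-flip : ∀ {x y} → x ≢ y → gap y x ≡ - gap x y
    gap-flip {x} {y} x≢y = trans
      (cong₂ (λ s t → (1ℤ - s) - t)
        (threshold-flip {to (rep y)} {to (rep x)} (x≢y ∘ sym ∘ col-injective))
        (threshold-flip {rep x} {rep y} λ eq → x≢y (trans (sym (res-rep≡ x)) (trans eq (res-rep≡ y)))))
      (negate (threshold (to (rep y)) (to (rep x))) (threshold (rep x) (rep y)))
      where
      negate : ∀ s t → (1ℤ - (1ℤ - s)) - (1ℤ - t) ≡ - ((1ℤ - s) - t)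
      negate = solve-∀

    -- For x < y the bound `lo x y` is 0, so only the threshold of the columns counts, and its
    -- parity is made of two ceilings and a descent.
    gap-parity : ∀ {x y} → x Fin.< y → par (gap x y) ≡ (v x ⊕ v y) ⊕ lt (res (to (rep x))) (res (to (rep y)))
    gap-parity {x} {y} x<y = begin
      par ((1ℤ - tc) - tr)                       ≡⟨ trans (par-minus (1ℤ - tc) tr) (cong (_⊕ par tr) (par-minus 1ℤ tc)) ⟩
      (1ℙ ⊕ par tc) ⊕ par tr                     ≡⟨ cong₂ (λ s t → (1ℙ ⊕ s) ⊕ t) (par-threshold (to (rep y)) (to (rep x))) (par-threshold (rep x) (rep y)) ⟩
      (1ℙ ⊕ (1ℙ ⊕ (cy ⊕ cx ⊕ inv-c))) ⊕ (1ℙ ⊕ (par (ceil (rep x)) ⊕ par (ceil (rep y)) ⊕ lt (res (rep y)) (res (rep x))))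
        ≡⟨ cong ((1ℙ ⊕ (1ℙ ⊕ (cy ⊕ cx ⊕ inv-c))) ⊕_) (cong (1ℙ ⊕_) (cong₂ _⊕_
             (cong₂ (λ s t → par s ⊕ par t) (ceil-rep≡ x) (ceil-rep≡ y))
             (trans (cong₂ lt (res-rep≡ y) (res-rep≡ x)) (lt-yes x<y)))) ⟩
      (1ℙ ⊕ (1ℙ ⊕ (cy ⊕ cx ⊕ inv-c))) ⊕ 0ℙ
        ≡⟨ solve 3 (λ a b c → (con 1ℙ :+ (con 1ℙ :+ (b :+ a :+ c))) :+ con 0ℙ := ((con 1ℙ :+ a) :+ (con 1ℙ :+ b)) :+ c) refl cx cy inv-c ⟩
      (v x ⊕ v y) ⊕ inv-c                        ∎
      where
      tc tr : ℤ
      tc = threshold (to (rep y)) (to (rep x))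
      tr = threshold (rep x) (rep y)
      cx cy inv-c : Parity
      cx = par (ceil (to (rep x)))
      cy = par (ceil (to (rep y)))
      inv-c = lt (res (to (rep x))) (res (to (rep y)))

    -- Pairing (x , y) with (y , x) replaces the truncated gaps by a signed one of known parity. In
    -- the sum over pairs every `v x` meets n - 1 partners.
    parity-triples : parity (length triples) ≡ (1ℙ ⊕ parity n) ⊗ sumOf v (allFin n) ⊕ colInversions
    parity-triples = begin
      parity (length triples)
        ≡⟨ parity-concatMap (λ x → concatMap (triplesFrom x) (allFin n)) (allFin n) ⟩
      sumOf (λ x → parity (length (concatMap (triplesFrom x) (allFin n)))) (allFin n)
        ≡⟨ sumOf-cong (allFin n) (λ x → trans (parity-concatMap (triplesFrom x) (allFin n)) (sumOf-cong (allFin n) (count x))) ⟩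
      sumOf (λ x → sumOf (λ y → parity (pos (gap x y))) (allFin n)) (allFin n)
        ≡⟨ sumOf²-pairSum (λ x y → parity (pos (gap x y))) (allFin n) ⟩
      sumOf (λ x → parity (pos (gap x x))) (allFin n) ⊕ pairSum (λ x y → parity (pos (gap x y)) ⊕ parity (pos (gap y x))) (allFin n)
        ≡⟨ cong₂ _⊕_ (trans (sumOf-cong (allFin n) gap-diagonal) (sumOf-0 (allFin n))) (pairSum-cong pair (allFin-increasing n)) ⟩
      pairSum (λ x y → (v x ⊕ v y) ⊕ lt (res (to (rep x))) (res (to (rep y)))) (allFin n)
        ≡⟨ pairSum-⊕ (λ x y → v x ⊕ v y) _ (allFin n) ⟩
      pairSum (λ x y → v x ⊕ v y) (allFin n) ⊕ colInversions
        ≡⟨ cong (_⊕ colInversions) (trans (pairSum-additive v (allFin n)) (cong (λ k → (1ℙ ⊕ parity k) ⊗ sumOf v (allFin n)) (List.length-tabulate {n = n} id))) ⟩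
      (1ℙ ⊕ parity n) ⊗ sumOf v (allFin n) ⊕ colInversions ∎
      where
      count : ∀ x y → parity (length (triplesFrom x y)) ≡ parity (pos (gap x y))
      count x y = cong parity (trans (List.length-map (λ k → x , y , k) (interval (lo x y) (hi x y))) (interval-length (lo x y) (hi x y)))
      pair : ∀ {x y} → x Fin.< y → parity (pos (gap x y)) ⊕ parity (pos (gap y x)) ≡ (v x ⊕ v y) ⊕ lt (res (to (rep x))) (res (to (rep y)))
      pair {x} {y} x<y = trans (cong (λ z → parity (pos (gap x y)) ⊕ parity (pos z)) (gap-flip (Fin.<⇒≢ x<y)))
        (trans (pos-neg (gap x y)) (gap-parity x<y))

    length-displacement : ∀ {ℓ} → IsLength w ℓ → parity ℓ ⊕ par (displacement w) ≡ crossings B ⊕ winding B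
    length-displacement {ℓ} (reps , isT) = begin
      parity ℓ ⊕ par (displacement w)
        ≡⟨ cong₂ _⊕_ (trans (cong parity (length-triples reps isT)) parity-triples) displacement-parity ⟩
      ((1ℙ ⊕ parity n) ⊗ sumOf v (allFin n) ⊕ colInversions) ⊕ parity n ⊗ sumOf v (allFin n)
        -- The length has n - 1 copies of the winding and the displacement has n, which leaves a
        -- single one.
        ≡⟨ solve 3 (λ n s c → ((con 1ℙ :+ n) :* s :+ c) :+ n :* s := c :+ s) refl (parity n) (sumOf v (allFin n)) colInversions ⟩
      colInversions ⊕ sumOf v (allFin n)
        ≡⟨ cong₂ _⊕_ crossings-B winding-B ⟨
      crossings B ⊕ winding B ∎

theorem4p4 : (n : ℕ) .{{_ : NonZero n}} (w : AffinePerm n) (ℓ : ℕ) → IsLength w ℓ →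
    ∀ {m} (P Q : Tabloid n m) (L : Vec ℕ m) (ρ : Vec ℤ m) →
    AMBC (toPartial w) (rows P) (rows Q) L ρ →
    (-1^ (+ ℓ)) * (-1^ displacement w) ≡ -1^ (+ inv P + + inv Q + + invShape L + invWeight L ρ)
theorem4p4 n w ℓ isLength P Q L ρ ambc = begin
  (-1^ (+ ℓ)) * (-1^ displacement w)
    ≡⟨ cong₂ _*_ (-1^-signOf (+ ℓ)) (-1^-signOf (displacement w)) ⟩
  signOf (parity ℓ) * signOf (par (displacement w))
    ≡⟨ signOf-⊕ (parity ℓ) (par (displacement w)) ⟨
  signOf (parity ℓ ⊕ par (displacement w))
    ≡⟨ cong signOf (length-displacement w isLength) ⟩
  signOf (crossings (B w) ⊕ winding (B w))
    -- The balls in rows 1, ..., n and those found along the recursion represent the same classes.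
    ≡⟨ cong signOf (cong₂ _⊕_ (transversal-crossings (affine-transversal w) s.transversal) (transversal-winding (affine-transversal w) s.transversal)) ⟩
  signOf (crossings s.balls ⊕ winding s.balls)
    ≡⟨ cong signOf s.sign ⟩
  signOf (parity (inv P) ⊕ parity (inv Q) ⊕ parity (invShape L) ⊕ par (invWeight L ρ))
    ≡⟨ cong (λ z → signOf (z ⊕ par (invWeight L ρ))) (trans (ℙ.+-homo-+ (inv P ℕ.+ inv Q) (invShape L)) (cong (_⊕ parity (invShape L)) (ℙ.+-homo-+ (inv P) (inv Q)))) ⟨
  signOf (par (+ inv P + + inv Q + + invShape L) ⊕ par (invWeight L ρ))
    ≡⟨ cong signOf (par-+ (+ inv P + + inv Q + + invShape L) (invWeight L ρ)) ⟨
  signOf (par (+ inv P + + inv Q + + invShape L + invWeight L ρ))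
    ≡⟨ -1^-signOf (+ inv P + + inv Q + + invShape L + invWeight L ρ) ⟨
  -1^ (+ inv P + + inv Q + + invShape L + invWeight L ρ) ∎
  where
  open Statistics n
  open Length n
  module s = Summary (summary n (Tabloid.disjoint P) (Tabloid.disjoint Q) ambc)
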